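{- For every constant $C>0$ there exists a constant $K>0$ such that for every integer $n\ge 2$ and every real $r$ with $1\le r\le n$ and $r\le n^{C/\log\log\log n}$, there exists a divisor $m$ of $n$ with $m\ge r$, $d(m)\le r^{K/\log\log r}$ and $\sigma(m)\le K m$.
   Context: $d(m)$ is the number of positive divisors of $m$ and $\sigma(m)$ is the sum of the positive divisors of $m$. Convention: $\log x$ denotes $\max(\ln x,1)$.
   Formalization: In the bound d(m) ≤ r^{K/log log r} the power is read as exp((K/log log r)·max(ln r,1)), so for r < e it says d(m) ≤ e^K; with the ordinary power the claim fails for r slightly above 1 (n = 2, m = 2). -}

module Defs where

open import Algebra.Bundles using (CommutativeRing)
open import Algebra.Definitions using (Congruent₁)
import Algebra.Definitions.RawMonoid as RawMonoidDefs
open import Data.List.Base using (List; filter; length; map; sum; upTo)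
open import Data.Nat.Base as ℕ using (ℕ; zero; suc)
open import Data.Nat.Divisibility using (_∣?_)
open import Data.Product.Base using (Σ-syntax; ∃-syntax; _×_; _,_; proj₁; proj₂)
open import Data.Sum.Base using (inj₁; inj₂)
open import Level using (Level; _⊔_) renaming (suc to lsuc)
open import Relation.Binary.Core using (Rel)
open import Relation.Binary.Definitions using (Antisymmetric; Cotransitive)
open import Relation.Binary.Lattice.Definitions using (Supremum)
open import Relation.Binary.Structures using (IsStrictPartialOrder)
open import Relation.Nullary.Negation using (¬_; contradiction)

-- For m = 0 the list is empty.
divisors : ℕ → List ℕ
divisors m = filter (_∣? m) (map suc (upTo m))

d : ℕ → ℕ
d m = length (divisors m)

σ : ℕ → ℕ
σ m = sum (divisors m)

-- The real numbers, given axiomatically as a Cauchy-complete Archimedean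
-- ordered field together with exp and ln. The order axioms are the
-- constructive ones (cotransitivity instead of trichotomy); with excluded
-- middle, the models are exactly the copies of the real line.
record Reals (c ℓ₁ ℓ₂ : Level) : Set (lsuc (c ⊔ ℓ₁ ⊔ ℓ₂)) where
  field
    commutativeRing : CommutativeRing c ℓ₁

  open CommutativeRing commutativeRing public
    renaming (Carrier to ℝ)
    hiding (zero)
  open RawMonoidDefs +-rawMonoid using () renaming (_×_ to _·_)

  infix 4 _<_ _≤_ _ConvergesTo_
  infixl 6 _∨_
  infixl 7 _/_
  infixr 8 _^_ _^ᴸ_

  field
    _<_ : Rel ℝ ℓ₂

  _≤_ : Rel ℝ ℓ₂
  x ≤ y = ¬ (y < x)

  ℝ⁺ : Set (c ⊔ ℓ₂)
  ℝ⁺ = Σ[ x ∈ ℝ ] 0# < x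

  fromℕ : ℕ → ℝ
  fromℕ n = n · 1#

  IsCauchy : (ℕ → ℝ) → Set (c ⊔ ℓ₂)
  IsCauchy f = ∀ ε → 0# < ε →
    ∃[ N ] (∀ m n → N ℕ.≤ m → N ℕ.≤ n → f m - f n < ε)

  _ConvergesTo_ : (ℕ → ℝ) → ℝ → Set (c ⊔ ℓ₂)
  f ConvergesTo L = ∀ ε → 0# < ε →
    ∃[ N ] (∀ n → N ℕ.≤ n → (f n - L < ε) × (L - f n < ε))

  field
    <-isStrictPartialOrder : IsStrictPartialOrder _≈_ _<_
    <-cotrans : Cotransitive _<_
    ≤-antisym : Antisymmetric _≈_ _≤_
    0<1       : 0# < 1#
    +-monoʳ-< : ∀ x {y z} → y < z → x + y < x + z
    *-pos     : ∀ {x y} → 0# < x → 0# < y → 0# < x * y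

    _∨_        : ℝ → ℝ → ℝ
    ∨-supremum : Supremum _≤_ _∨_

    recip      : ℝ⁺ → ℝ
    *-inverseʳ : ∀ x → proj₁ x * recip x ≈ 1#

    archimedean : ∀ x → ∃[ n ] x < fromℕ n
    complete    : ∀ f → IsCauchy f → ∃[ L ] f ConvergesTo L

    -- The next three laws determine exp: they force
    -- (1 + x/n)ⁿ ≤ exp x ≤ (1 - x/n)⁻ⁿ for all n > |x|.
    exp      : ℝ → ℝ
    exp-cong : Congruent₁ _≈_ exp
    exp-+    : ∀ x y → exp (x + y) ≈ exp x * exp y
    1+x≤exp  : ∀ x → 1# + x ≤ exp x

    ln     : ℝ⁺ → ℝ
    exp-ln : ∀ x → exp (ln x) ≈ proj₁ x

  open IsStrictPartialOrder <-isStrictPartialOrder public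
    using (<-resp-≈; <-respˡ-≈; <-respʳ-≈)
    renaming (trans to <-trans; irrefl to <-irrefl; asym to <-asym)

  1≤x⇒0<x : ∀ {x} → 1# ≤ x → 0# < x
  1≤x⇒0<x {x} 1≤x with <-cotrans 0<1 x
  ... | inj₁ 0<x = 0<x
  ... | inj₂ x<1 = contradiction x<1 1≤x

  0<fromℕ : ∀ {n} → 0 ℕ.< n → 0# < fromℕ n
  0<fromℕ {suc zero}    _ = <-respʳ-≈ (sym (+-identityʳ 1#)) 0<1
  0<fromℕ {suc (suc n)} _ =
    <-trans (<-respʳ-≈ (sym (+-identityʳ 1#)) 0<1)
            (+-monoʳ-< 1# (0<fromℕ {suc n} (ℕ.s≤s ℕ.z≤n)))

  fromℕ⁺ : ∀ n → 0 ℕ.< n → ℝ⁺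
  fromℕ⁺ n 0<n = fromℕ n , 0<fromℕ 0<n

  _/_ : ℝ → ℝ⁺ → ℝ
  x / y = x * recip y

  -- log x means max (ln x) 1, so that iterated logarithms are always defined
  -- and at least 1.
  log : ℝ⁺ → ℝ⁺
  log x = ln x ∨ 1# , 1≤x⇒0<x (proj₁ (proj₂ (∨-supremum (ln x) 1#)))

  _^_ : ℝ⁺ → ℝ → ℝ
  x ^ y = exp (y * ln x)

  -- The power with the above convention applied to the logarithm of the base:
  -- it is x ^ y when x ≥ e, and exp y when x < e. In bounds of the form
  -- d(m) ≤ r^(K / log log r) with m ≥ r the ordinary power would fail for r
  -- close to 1: for n = 2 and 1 < r ≤ 2 the only divisor m ≥ r is 2, while
  -- r ^ K tends to 1 < d(2) as r tends to 1.
  _^ᴸ_ : ℝ⁺ → ℝ → ℝ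
  x ^ᴸ y = exp (y * proj₁ (log x))

{-# OPTIONS --safe #-}
-- Let B be a power of 4 that is large in terms of C. The prime factors p of n are divided into G + 1 classes
-- B^g ≲ log p ≲ B^(g+1), the last one being unbounded above, where G + 1 is about log log log n / log B.
-- By Chebyshev's bound the product of p / (p - 1) over each class is at most a constant. Some class
-- contributes at least n^(1/(G+1)) ≥ r to n. Multiplying primes of that class until r is reached gives m, which is
-- either a prime or at most about r², so that d(m) obeys the general bound exp (O(log r / log log r)).
module Submission where

open import Defs
import Algebra.Properties.Group as GroupProperties
import Algebra.Properties.Monoid.Mult as MonoidMult
import Algebra.Properties.Semiring.Mult as SemiringMult
open import Data.List.Base using (List; []; _∷_; _++_; cartesianProductWith; filter; length; map; upTo)
open import Data.List.Membership.Propositional using (_∈_)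
open import Data.List.Membership.Propositional.Properties
  using (∈-∃++; ∈-filter⁺; ∈-filter⁻; ∈-map⁺; ∈-upTo⁺; ∈-++⁺ˡ; ∈-++⁺ʳ; ∈-++⁻; ∈-cartesianProductWith⁺)
open import Data.List.Properties using (length-++; length-filter; length-map; map-++)
open import Data.List.Relation.Binary.Permutation.Propositional using (_↭_; ↭-refl; ↭-trans; prep)
open import Data.List.Relation.Binary.Permutation.Propositional.Properties using (shift; ↭-length)
open import Data.List.Relation.Binary.Subset.Propositional using (_⊆_)
open import Data.List.Relation.Unary.All as All using (All; []; _∷_)
import Data.List.Relation.Unary.All.Properties as AllP
open import Data.List.Relation.Unary.AllPairs using ([]; _∷_)
open import Data.List.Relation.Unary.Any using (here; there)
open import Data.List.Relation.Unary.Unique.Propositional using (Unique)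
import Data.List.Relation.Unary.Unique.Propositional.Properties as Unique
open import Data.Nat.Base as ℕ using (ℕ; zero; suc)
open import Data.Nat.Coprimality using (Coprime; coprime-divisor; coprime-/gcd)
open import Data.Nat.Divisibility
open import Data.Nat.DivMod using (m/n*n≡m)
open import Data.Nat.GCD using (gcd; gcd[m,n]∣m; gcd[m,n]∣n; gcd[m,n]≢0)
open import Data.Nat.ListAction using (sum; product)
open import Data.Nat.ListAction.Properties using (sum-++; sum-↭; product-++; ∈⇒∣product)
open import Data.Nat.Primality
open import Data.Nat.Primality.Factorisation using (PrimeFactorisation; factorise)
import Data.Nat.Properties as ℕₚ
open import Data.Nat.Tactic.RingSolver using (solve-∀)
open import Data.Product.Base using (_×_; _,_; ∃-syntax; ∃₂; proj₁; proj₂)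
open import Data.Sum.Base using (_⊎_; inj₁; inj₂)
open import Function.Base using (_∘_; id)
open import Level using (Level)
open import Relation.Binary.Bundles using (Poset)
import Relation.Binary.PropositionalEquality as ≡
open import Relation.Nullary.Decidable using (yes; no; _×-dec_; from-yes)
open import Relation.Nullary.Negation using (¬_; contradiction)
open import Relation.Unary using (Pred; Decidable)
open import Relation.Unary.Properties using (∁?)

-- The ratio σ(m)/m is controlled by the product of p/(p-1) over the primes of m, and by Mertens'
-- theorem this product over a range of primes is about the ratio of the logarithms of its ends.
-- This is why a class lets log p vary by a bounded factor B only. A tail is cheap: if n < 4^θ, then
-- n has fewer than θ prime factors above θ, and together they contribute at most a factor 2. So
-- only primes up to about log n have to be split, their log p runs up to about log log n, and the
-- triple logarithm appears in the number of classes. With c > C and B = 4^(4 (c + 1)), the index G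
-- of the last class satisfies 2 (G + 1) (c + 1) ≤ log log log n as soon as G ≥ 1, hence r^(2 (G +
-- 1)) ≤ n. The spare factor 2 in the exponent pays for replacing the real r by a natural number R ≤
-- 4 r. For G = 0 it is enough that R ≤ n. The divisor estimates are carried out in ℕ: fractions are
-- multiplied out, and logarithms become exponents of 2 and 4.

module Arithmetic where
  open import Data.Nat.Base
  open import Data.Nat.Combinatorics using (_C_; nCk≡n!/k![n-k]!; nCk+nC[k+1]≡[n+1]C[k+1]; k![n∸k]!∣n!)
  open import Data.Nat.Properties
  open ≡ using (_≡_; refl; sym; trans; cong; cong₂; subst; subst₂; module ≡-Reasoning)

  -- Covering lists of divisors; submultiplicativity of `d` and `σ`

  Unique-⊆⇒↭++ : ∀ {xs ys : List ℕ} → Unique xs → xs ⊆ ys → ∃[ zs ] ys ↭ xs ++ zs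
  Unique-⊆⇒↭++ {[]} {ys} _ _ = ys , ↭-refl
  Unique-⊆⇒↭++ {x ∷ xs} (x∉ ∷ u) sub with ∈-∃++ (sub (here refl))
  ... | as , bs , refl with Unique-⊆⇒↭++ {xs} {as ++ bs} u sub′
    where
    sub′ : xs ⊆ as ++ bs
    sub′ {y} y∈ with ∈-++⁻ as (sub (there y∈))
    ... | inj₁ p = ∈-++⁺ˡ p
    ... | inj₂ (here y≡x) = contradiction (sym y≡x) (All.lookup x∉ y∈)
    ... | inj₂ (there p) = ∈-++⁺ʳ as p
  ... | zs , p = zs , ↭-trans (shift x as bs) (prep x p)

  length-⊆ : ∀ {xs ys : List ℕ} → Unique xs → xs ⊆ ys → length xs ≤ length ys
  length-⊆ {xs} u s with Unique-⊆⇒↭++ u s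
  ... | zs , p = subst (length xs ≤_) (sym (trans (↭-length p) (length-++ xs))) (m≤m+n _ _)

  sum-⊆ : ∀ {xs ys : List ℕ} → Unique xs → xs ⊆ ys → sum xs ≤ sum ys
  sum-⊆ {xs} u s with Unique-⊆⇒↭++ u s
  ... | zs , p = subst (sum xs ≤_) (sym (trans (sum-↭ p) (sum-++ xs zs))) (m≤m+n _ _)

  divisors-unique : ∀ m → Unique (divisors m)
  divisors-unique m = Unique.filter⁺ (_∣? m) (Unique.map⁺ suc-injective (Unique.upTo⁺ m))

  ∈-divisors⁻ : ∀ {e} m → e ∈ divisors m → e ∣ m
  ∈-divisors⁻ m p = proj₂ (∈-filter⁻ (_∣? m) {xs = map suc (upTo m)} p)

  ∈-divisors⁺ : ∀ {e m} .{{_ : NonZero m}} → e ∣ m → e ∈ divisors m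
  ∈-divisors⁺ {zero} {m} 0∣m = contradiction (0∣⇒≡0 0∣m) (≢-nonZero⁻¹ m)
  ∈-divisors⁺ {suc e} {m} e∣m = ∈-filter⁺ (_∣? m) (∈-map⁺ suc (∈-upTo⁺ (∣⇒≤ e∣m))) e∣m

  -- A covering list may contain repetitions and non-divisors, so any convenient enumeration gives
  -- an upper bound for `d` and, below, for `σ`.
  d-cover : ∀ {m ys} → (∀ {e} → e ∣ m → e ∈ ys) → d m ≤ length ys
  d-cover {m} c = length-⊆ (divisors-unique m) (c ∘ ∈-divisors⁻ m)

  σ-cover : ∀ {m ys} → (∀ {e} → e ∣ m → e ∈ ys) → σ m ≤ sum ys
  σ-cover {m} c = sum-⊆ (divisors-unique m) (c ∘ ∈-divisors⁻ m)

  -- Take x = gcd(e, a). Then e/x is coprime to a/x and divides (a/x) b, hence divides b. As a and b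
  -- may share factors, this yields submultiplicativity rather than multiplicativity.
  ∣*⇒∃∣*∣ : ∀ {e} a b .{{_ : NonZero a}} → e ∣ a * b → ∃₂ λ x y → x ∣ a × y ∣ b × e ≡ x * y
  ∣*⇒∃∣*∣ {e} a b e∣ab = gcd e a , quotient x∣e , gcd[m,n]∣n e a , y∣b , m∣n⇒n≡m*quotient x∣e
    where
    instance
      x≢0 : NonZero (gcd e a)
      x≢0 = ≢-nonZero (gcd[m,n]≢0 e a (inj₂ (≢-nonZero⁻¹ a)))
    x∣e = gcd[m,n]∣m e a
    x∣a = gcd[m,n]∣n e a
    cop : Coprime (quotient x∣e) (quotient x∣a)
    cop = subst₂ Coprime (n/m≡quotient x∣e) (n/m≡quotient x∣a) (coprime-/gcd e a)
    y∣b : quotient x∣e ∣ b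
    y∣b = coprime-divisor cop (*-cancelˡ-∣ (gcd e a) (subst₂ _∣_ (m∣n⇒n≡m*quotient x∣e)
            (trans (cong (_* b) (m∣n⇒n≡m*quotient x∣a)) (*-assoc (gcd e a) _ b)) e∣ab))

  products : List ℕ → List ℕ → List ℕ
  products = cartesianProductWith _*_

  length-products : ∀ xs ys → length (products xs ys) ≡ length xs * length ys
  length-products [] ys = refl
  length-products (x ∷ xs) ys = trans (length-++ (map (x *_) ys))
    (cong₂ _+_ (length-map (x *_) ys) (length-products xs ys))

  sum-map-* : ∀ x ys → sum (map (x *_) ys) ≡ x * sum ys
  sum-map-* x [] = sym (*-zeroʳ x)
  sum-map-* x (y ∷ ys) = trans (cong (x * y +_) (sum-map-* x ys)) (sym (*-distribˡ-+ x y (sum ys)))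

  sum-products : ∀ xs ys → sum (products xs ys) ≡ sum xs * sum ys
  sum-products [] ys = refl
  sum-products (x ∷ xs) ys = trans (sum-++ (map (x *_) ys) _)
    (trans (cong₂ _+_ (sum-map-* x ys) (sum-products xs ys)) (sym (*-distribʳ-+ (sum ys) x (sum xs))))

  ∣*⇒∈products : ∀ {e} a b .{{_ : NonZero a}} .{{_ : NonZero b}} →
    e ∣ a * b → e ∈ products (divisors a) (divisors b)
  ∣*⇒∈products a b e∣ab with ∣*⇒∃∣*∣ a b e∣ab
  ... | x , y , x∣a , y∣b , refl = ∈-cartesianProductWith⁺ _*_ (∈-divisors⁺ x∣a) (∈-divisors⁺ y∣b)

  d-* : ∀ a b .{{_ : NonZero a}} .{{_ : NonZero b}} → d (a * b) ≤ d a * d b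
  d-* a b = ≤-trans (d-cover (∣*⇒∈products a b)) (≤-reflexive (length-products (divisors a) (divisors b)))

  σ-* : ∀ a b .{{_ : NonZero a}} .{{_ : NonZero b}} → σ (a * b) ≤ σ a * σ b
  σ-* a b = ≤-trans (σ-cover (∣*⇒∈products a b)) (≤-reflexive (sum-products (divisors a) (divisors b)))

  -- Divisors of prime powers

  powers : ℕ → ℕ → List ℕ
  powers p zero    = 1 ∷ []
  powers p (suc v) = p ^ suc v ∷ powers p v

  length-powers : ∀ p v → length (powers p v) ≡ suc v
  length-powers p zero = refl
  length-powers p (suc v) = cong suc (length-powers p v)

  -- The geometric series for the base p = q + 1, arranged so that no subtraction occurs.
  sum-powers : ∀ q v → suc (sum (powers (suc q) v) * q) ≡ suc q ^ suc v
  sum-powers q zero = cong suc (trans (+-identityʳ q) (sym (*-identityʳ q)))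
  sum-powers q (suc v) = begin
    suc ((P + S) * q)   ≡⟨ lemma P S q ⟩
    P * q + suc (S * q) ≡⟨ cong (P * q +_) (sum-powers q v) ⟩
    P * q + P           ≡⟨ lemma′ P q ⟩
    suc q * P           ∎
    where
    open ≡-Reasoning
    P = suc q ^ suc v
    S = sum (powers (suc q) v)
    lemma : ∀ P S q → suc ((P + S) * q) ≡ P * q + suc (S * q)
    lemma = solve-∀
    lemma′ : ∀ P q → P * q + P ≡ suc q * P
    lemma′ = solve-∀

  prime∤⇒coprime : ∀ {p e} → Prime p → ¬ p ∣ e → Coprime e p
  prime∤⇒coprime pr p∤e (k∣e , k∣p) with prime⇒irreducible pr k∣p
  ... | inj₁ k≡1 = k≡1
  ... | inj₂ refl = contradiction k∣e p∤e

  *-powers : ∀ {e p} v → e ∈ powers p v → p * e ∈ powers p (suc v)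
  *-powers zero (here refl) = here refl
  *-powers (suc v) (here refl) = here refl
  *-powers (suc v) (there e∈) = there (*-powers v e∈)

  ∣^⇒∈powers : ∀ {p} → Prime p → ∀ v {e} → e ∣ p ^ v → e ∈ powers p v
  ∣^⇒∈powers pr zero e∣1 = here (∣1⇒≡1 e∣1)
  ∣^⇒∈powers {p} pr (suc v) {e} e∣ with p ∣? e
  ... | no p∤e = there (∣^⇒∈powers pr v (coprime-divisor (prime∤⇒coprime pr p∤e) e∣))
  ... | yes p∣e = subst (_∈ powers p (suc v)) (sym eq) (*-powers v
          (∣^⇒∈powers pr v (*-cancelˡ-∣ p (subst (_∣ p * p ^ v) eq e∣))))
    where
    instance _ = prime⇒nonZero pr
    eq = m∣n⇒n≡m*quotient p∣e

  d-prime^ : ∀ {p} → Prime p → ∀ v → d (p ^ v) ≤ suc v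
  d-prime^ {p} pr v = ≤-trans (d-cover (∣^⇒∈powers pr v)) (≤-reflexive (length-powers p v))

  -- This is σ(p^v)/p^v ≤ p/(p-1) multiplied out; all later bounds on σ(m)/m keep numerators and
  -- denominators apart in the same way.
  σ-prime^ : ∀ {p} → Prime p → ∀ v → σ (p ^ v) * pred p ≤ p ^ v * p
  σ-prime^ {zero} pr v = ≤-trans (≤-reflexive (*-zeroʳ (σ (zero ^ v)))) z≤n
  σ-prime^ {p@(suc q)} pr v = begin
    σ (p ^ v) * q              ≤⟨ *-monoˡ-≤ q (σ-cover (∣^⇒∈powers pr v)) ⟩
    sum (powers p v) * q       ≤⟨ n≤1+n _ ⟩
    suc (sum (powers p v) * q) ≡⟨ sum-powers q v ⟩
    p * p ^ v                  ≡⟨ *-comm p (p ^ v) ⟩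
    p ^ v * p                  ∎
    where open ≤-Reasoning

  -- Products of primes taken from a given list

  module _ {p : Level} {P : Pred ℕ p} (P? : Decidable P) where

    product-filter : ∀ xs → product xs ≡ product (filter P? xs) * product (filter (∁? P?) xs)
    product-filter [] = refl
    product-filter (x ∷ xs) with P? x
    ... | yes _ = trans (cong (x *_) (product-filter xs)) (sym (*-assoc x _ _))
    ... | no _ = trans (cong (x *_) (product-filter xs))
           (lemma x (product (filter P? xs)) (product (filter (∁? P?) xs)))
      where
      lemma : ∀ x a b → x * (a * b) ≡ a * (x * b)
      lemma = solve-∀

    All-filter : ∀ {ℓ} {R : Pred ℕ ℓ} {xs} → All R xs → All R (filter P? xs)
    All-filter {xs = xs} a = All.tabulate λ x∈ → All.lookup a (proj₁ (∈-filter⁻ P? {xs = xs} x∈))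

  product-all-≡ : ∀ {q xs} → All (_≡ q) xs → product xs ≡ q ^ length xs
  product-all-≡ [] = refl
  product-all-≡ {q} (refl ∷ a) = cong (q *_) (product-all-≡ a)

  module Extract (q : ℕ) (fs : List ℕ) where
    rest : List ℕ
    rest = filter (∁? (_≟ q)) fs
    exponent : ℕ
    exponent = length (filter (_≟ q) fs)
    product-extract : product fs ≡ q ^ exponent * product rest
    product-extract = trans (product-filter (_≟ q) fs)
      (cong (_* product rest) (product-all-≡ (AllP.all-filter (_≟ q) fs)))
    rest-⊆ : ∀ {Q} → fs ⊆ q ∷ Q → rest ⊆ Q
    rest-⊆ s x∈ with ∈-filter⁻ (∁? (_≟ q)) {xs = fs} x∈
    ... | x∈fs , x≢q with s x∈fs
    ...   | here x≡q = contradiction x≡q x≢q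
    ...   | there x∈Q = x∈Q

  -- Induction on `Q`: separating the copies of one prime q leaves a product over the remaining
  -- primes, and q offers at most L + 1 exponents.
  d-smooth : ∀ L Q {fs} → All Prime Q → All Prime fs → fs ⊆ Q → length fs ≤ L →
    d (product fs) ≤ suc L ^ length Q
  d-smooth L [] {[]} _ _ _ _ = ≤-refl
  d-smooth L [] {x ∷ fs} _ _ s _ with s (here refl)
  ... | ()
  d-smooth L (q ∷ Q) {fs} (q-pr ∷ Q-pr) fs-pr s l = begin
    d (product fs)                        ≡⟨ cong d product-extract ⟩
    d (q ^ exponent * product rest)       ≤⟨ d-* (q ^ exponent) (product rest) ⟩
    d (q ^ exponent) * d (product rest)   ≤⟨ *-mono-≤
      (≤-trans (d-prime^ q-pr exponent) (s≤s (≤-trans (length-filter (_≟ q) fs) l)))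
      (d-smooth L Q Q-pr rest-pr (rest-⊆ s) (≤-trans (length-filter (∁? (_≟ q)) fs) l)) ⟩
    suc L * suc L ^ length Q              ∎
    where
    open ≤-Reasoning
    open Extract q fs
    rest-pr = All-filter (∁? (_≟ q)) fs-pr
    instance
      _ = productOfPrimes≢0 rest-pr
      _ = m^n≢0 q exponent {{prime⇒nonZero q-pr}}

  product⁻ : List ℕ → ℕ
  product⁻ Q = product (map pred Q)

  -- The same induction, with each prime paying q/(q-1). A q absent from `fs` is harmless, since it
  -- has exponent 0 and its factor is at least 1; so one list `Q` per class serves every m composed
  -- of its primes.
  σ-smooth : ∀ Q {fs} → All Prime Q → All Prime fs → fs ⊆ Q →
    σ (product fs) * product⁻ Q ≤ product fs * product Q
  σ-smooth [] {[]} _ _ _ = ≤-refl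
  σ-smooth [] {x ∷ fs} _ _ s with s (here refl)
  ... | ()
  σ-smooth (q ∷ Q) {fs} (q-pr ∷ Q-pr) fs-pr s = begin
    σ (product fs) * (pred q * product⁻ Q)
      ≡⟨ cong (λ x → σ x * (pred q * product⁻ Q)) product-extract ⟩
    σ (q ^ exponent * product rest) * (pred q * product⁻ Q)
      ≤⟨ *-monoˡ-≤ (pred q * product⁻ Q) (σ-* (q ^ exponent) (product rest)) ⟩
    σ (q ^ exponent) * σ (product rest) * (pred q * product⁻ Q)
      ≡⟨ swap (σ (q ^ exponent)) (σ (product rest)) (pred q) (product⁻ Q) ⟩
    (σ (q ^ exponent) * pred q) * (σ (product rest) * product⁻ Q)
      ≤⟨ *-mono-≤ (σ-prime^ q-pr exponent) (σ-smooth Q Q-pr rest-pr (rest-⊆ s)) ⟩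
    (q ^ exponent * q) * (product rest * product Q)
      ≡⟨ swap (q ^ exponent) q (product rest) (product Q) ⟩
    (q ^ exponent * product rest) * (q * product Q)
      ≡⟨ cong (_* (q * product Q)) product-extract ⟨
    product fs * (q * product Q)    ∎
    where
    open ≤-Reasoning
    open Extract q fs
    rest-pr = All-filter (∁? (_≟ q)) fs-pr
    swap : ∀ a b c e → a * b * (c * e) ≡ (a * c) * (b * e)
    swap = solve-∀
    instance
      _ = productOfPrimes≢0 rest-pr
      _ = m^n≢0 q exponent {{prime⇒nonZero q-pr}}

  -- Products of q/(q-1) over parts of an interval

  interval : ℕ → ℕ → List ℕ
  interval N zero    = []
  interval N (suc l) = suc N ∷ interval (suc N) l

  ∈-interval⁺ : ∀ {N x} l → N < x → x ≤ N + l → x ∈ interval N l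
  ∈-interval⁺ {N} {x} zero N<x x≤ = contradiction (subst (x ≤_) (+-identityʳ N) x≤) (<⇒≱ N<x)
  ∈-interval⁺ {N} {x} (suc l) N<x x≤ with x ≟ suc N
  ... | yes eq = here eq
  ... | no neq = there (∈-interval⁺ l (≤∧≢⇒< N<x (neq ∘ sym)) (subst (x ≤_) (+-suc N l) x≤))

  interval> : ∀ N l → All (N <_) (interval N l)
  interval> N zero = []
  interval> N (suc l) = ≤-refl ∷ All.map (<-trans ≤-refl) (interval> (suc N) l)

  interval≤ : ∀ N l → All (_≤ N + l) (interval N l)
  interval≤ N zero = []
  interval≤ N (suc l) = subst (λ m → All (_≤ m) (interval N (suc l))) (sym (+-suc N l))
    (m≤m+n (suc N) l ∷ interval≤ (suc N) l)

  interval-unique : ∀ N l → Unique (interval N l)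
  interval-unique N zero = []
  interval-unique N (suc l) = All.map <⇒≢ (interval> (suc N) l) ∷ interval-unique (suc N) l

  length-interval : ∀ N l → length (interval N l) ≡ l
  length-interval N zero = refl
  length-interval N (suc l) = cong suc (length-interval (suc N) l)

  -- The product of q / (q - 1) over c numbers q > N is largest for N + 1, …, N + c, where it telescopes.
  telescope : ∀ {p} {P : Pred ℕ p} (P? : Decidable P) N l →
    let Q = filter P? (interval N l) in N * product Q ≤ (N + length Q) * product⁻ Q
  telescope P? N zero = *-monoˡ-≤ 1 (m≤m+n N 0)
  telescope P? N (suc l) with P? (suc N) | telescope P? (suc N) l
  ... | yes _ | ih = begin
    N * (suc N * product Q)              ≤⟨ *-monoʳ-≤ N ih ⟩
    N * ((suc N + length Q) * product⁻ Q) ≡⟨ lemma N (length Q) (product⁻ Q) ⟩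
    (N + suc (length Q)) * (N * product⁻ Q) ∎
    where
    open ≤-Reasoning
    Q = filter P? (interval (suc N) l)
    lemma : ∀ N c b → N * ((suc N + c) * b) ≡ (N + suc c) * (N * b)
    lemma = solve-∀
  ... | no _ | ih = *-cancelˡ-≤ (suc N) (begin
    suc N * (N * product Q)               ≡⟨ lemma N (product Q) ⟩
    N * (suc N * product Q)               ≤⟨ *-monoʳ-≤ N ih ⟩
    N * ((suc N + length Q) * product⁻ Q) ≤⟨ m≤m+n _ (length Q * product⁻ Q) ⟩
    N * ((suc N + length Q) * product⁻ Q) + length Q * product⁻ Q ≡⟨ lemma′ N (length Q) (product⁻ Q) ⟩
    suc N * ((N + length Q) * product⁻ Q) ∎)
    where
    open ≤-Reasoning
    Q = filter P? (interval (suc N) l)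
    lemma : ∀ N a → suc N * (N * a) ≡ N * (suc N * a)
    lemma = solve-∀
    lemma′ : ∀ N c b → N * ((suc N + c) * b) + c * b ≡ suc N * ((N + c) * b)
    lemma′ = solve-∀

  -- Chebyshev's upper bound from the central binomial coefficient

  product-∣ : ∀ {Q X} → Unique Q → All Prime Q → All (_∣ X) Q → product Q ∣ X
  product-∣ {[]} _ _ _ = 1∣ _
  product-∣ {q ∷ Q} (q∉ ∷ u) (q-pr ∷ Q-pr) (divides Y refl ∷ Q∣X) = subst (q * product Q ∣_) (*-comm q Y)
    (*-monoʳ-∣ q (product-∣ {Q} {Y} u Q-pr (All.tabulate divide)))
    where
    -- The prime x divides Y q but differs from the prime q, so it still divides the cofactor Y.
    divide : ∀ {x} → x ∈ Q → x ∣ Y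
    divide {x} x∈ with euclidsLemma Y q (All.lookup Q-pr x∈) (All.lookup Q∣X x∈)
    ... | inj₁ x∣Y = x∣Y
    ... | inj₂ x∣q with prime⇒irreducible q-pr x∣q
    ...   | inj₁ refl = contradiction (All.lookup Q-pr x∈) ¬prime[1]
    ...   | inj₂ refl = contradiction refl (All.lookup q∉ x∈)

  ^length≤product : ∀ {N Q} → All (N ≤_) Q → N ^ length Q ≤ product Q
  ^length≤product [] = ≤-refl
  ^length≤product (N≤q ∷ a) = *-mono-≤ N≤q (^length≤product a)

  ^-cancelʳ-≤ : ∀ {a b} m → 1 < m → m ^ a ≤ m ^ b → a ≤ b
  ^-cancelʳ-≤ m 1<m le = ≮⇒≥ λ b<a → contradiction le (<⇒≱ (^-monoʳ-< m 1<m b<a))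

  ^-cancelʳ-< : ∀ {a b} m → 1 < m → m ^ a < m ^ b → a < b
  ^-cancelʳ-< m@(suc _) 1<m lt = ≰⇒> λ b≤a → contradiction lt (≤⇒≯ (^-monoʳ-≤ m b≤a))

  nCk≤2^n : ∀ n k → n C k ≤ 2 ^ n
  nCk≤2^n n zero = m^n>0 2 n
  nCk≤2^n zero (suc k) = z≤n
  nCk≤2^n (suc n) (suc k) = begin
    suc n C suc k       ≡⟨ nCk+nC[k+1]≡[n+1]C[k+1] n k ⟨
    n C k + n C suc k   ≤⟨ +-mono-≤ (nCk≤2^n n k) (nCk≤2^n n (suc k)) ⟩
    2 ^ n + 2 ^ n       ≡⟨ cong (2 ^ n +_) (+-identityʳ (2 ^ n)) ⟨
    2 ^ suc n           ∎
    where open ≤-Reasoning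

  prime∣!⇒≤ : ∀ {p} → Prime p → ∀ n → p ∣ n ! → p ≤ n
  prime∣!⇒≤ pr zero p∣ = contradiction (subst Prime (∣1⇒≡1 p∣) pr) ¬prime[1]
  prime∣!⇒≤ pr (suc n) p∣ with euclidsLemma (suc n) (n !) pr p∣
  ... | inj₁ p∣n = ∣⇒≤ p∣n
  ... | inj₂ p∣n! = m≤n⇒m≤1+n (prime∣!⇒≤ pr n p∣n!)

  centralBinomial-! : ∀ N → ((N + N) C N) * (N ! * N !) ≡ (N + N) !
  centralBinomial-! N = begin
    ((N + N) C N) * (N ! * N !)
      ≡⟨ cong (λ m → ((N + N) C N) * (N ! * m !)) (m+n∸m≡n N N) ⟨
    ((N + N) C N) * (N ! * (N + N ∸ N) !)
      ≡⟨ cong (_* (N ! * (N + N ∸ N) !)) (nCk≡n!/k![n-k]! (m≤m+n N N)) ⟩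
    (N + N) ! / (N ! * (N + N ∸ N) !) * (N ! * (N + N ∸ N) !)
      ≡⟨ m/n*n≡m (k![n∸k]!∣n! (m≤m+n N N)) ⟩
    (N + N) ! ∎
    where
    open ≡-Reasoning
    instance _ = N !* (N + N ∸ N) !≢0

  n∣n! : ∀ n .{{_ : NonZero n}} → n ∣ n !
  n∣n! (suc n) = m∣m*n (n !)

  -- Such a p divides (2N)! but, being larger than N, neither copy of N! in the denominator.
  prime∣centralBinomial : ∀ {p} → Prime p → ∀ N → N < p → p ≤ N + N → p ∣ (N + N) C N
  prime∣centralBinomial {p} pr N N<p p≤2N
    with euclidsLemma ((N + N) C N) (N ! * N !) pr (subst (p ∣_) (sym (centralBinomial-! N)) p∣2N!)
    where
    instance _ = prime⇒nonZero pr
    p∣2N! : p ∣ (N + N) !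
    p∣2N! = ∣-trans (n∣n! p) (m≤n⇒m!∣n! p≤2N)
  ... | inj₁ p∣C = p∣C
  ... | inj₂ p∣ with euclidsLemma (N !) (N !) pr p∣
  ...   | inj₁ p∣N! = contradiction (prime∣!⇒≤ pr N p∣N!) (<⇒≱ N<p)
  ...   | inj₂ p∣N! = contradiction (prime∣!⇒≤ pr N p∣N!) (<⇒≱ N<p)

  primesIn : ℕ → ℕ → List ℕ
  primesIn N l = filter prime? (interval N l)

  primesIn-prime : ∀ N l → All Prime (primesIn N l)
  primesIn-prime N l = AllP.all-filter prime? (interval N l)

  ∈-primesIn : ∀ {p N} l → Prime p → N < p → p ≤ N + l → p ∈ primesIn N l
  ∈-primesIn l pr N<p p≤ = ∈-filter⁺ prime? (∈-interval⁺ l N<p p≤) pr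

  -- With N = 2^k, the primes in (N, 2N] have a product that is at least N^count and divides the
  -- binomial coefficient, which is at most 2^(2N). Choosing N as a power of 2 reduces the claim to
  -- comparing exponents of 2.
  chebyshev : ∀ k → k * length (primesIn (2 ^ k) (2 ^ k)) ≤ 2 ^ k + 2 ^ k
  chebyshev k = ^-cancelʳ-≤ 2 (s≤s (s≤s z≤n)) (begin
    2 ^ (k * length Q) ≡⟨ ^-*-assoc 2 k (length Q) ⟨
    N ^ length Q       ≤⟨ ^length≤product (All.map <⇒≤ (All-filter prime? (interval> N N))) ⟩
    product Q          ≤⟨ ∣⇒≤ (product-∣ (Unique.filter⁺ prime? (interval-unique N N)) (primesIn-prime N N) (All.tabulate divide)) ⟩
    (N + N) C N        ≤⟨ nCk≤2^n (N + N) N ⟩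
    2 ^ (N + N)        ∎)
    where
    open ≤-Reasoning
    N = 2 ^ k
    Q = primesIn N N
    instance
      C≢0 : NonZero ((N + N) C N)
      C≢0 = ≢-nonZero λ eq → contradiction (trans (sym (centralBinomial-! N)) (cong (_* (N ! * N !)) eq))
              (≢-nonZero⁻¹ ((N + N) !) {{(N + N) !≢0}})
    divide : ∀ {x} → x ∈ Q → x ∣ (N + N) C N
    divide x∈ with ∈-filter⁻ prime? {xs = interval N N} x∈
    ... | x∈I , pr = prime∣centralBinomial pr N (All.lookup (interval> N N) x∈I) (All.lookup (interval≤ N N) x∈I)

  -- A Mertens-type bound over dyadic ranges

  dyadicPrimes : ℕ → ℕ → List ℕ
  dyadicPrimes a zero    = []
  dyadicPrimes a (suc l) = dyadicPrimes a l ++ primesIn (2 ^ (a + l)) (2 ^ (a + l))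

  dyadicPrimes-prime : ∀ a l → All Prime (dyadicPrimes a l)
  dyadicPrimes-prime a zero = []
  dyadicPrimes-prime a (suc l) = AllP.++⁺ (dyadicPrimes-prime a l) (primesIn-prime (2 ^ (a + l)) (2 ^ (a + l)))

  2*m≡m+m : ∀ m → 2 * m ≡ m + m
  2*m≡m+m = solve-∀

  ∈-dyadicPrimes : ∀ {p} a l → Prime p → 2 ^ a < p → p ≤ 2 ^ (a + l) → p ∈ dyadicPrimes a l
  ∈-dyadicPrimes {p} a zero pr a<p p≤ = contradiction (subst (λ x → p ≤ 2 ^ x) (+-identityʳ a) p≤) (<⇒≱ a<p)
  ∈-dyadicPrimes {p} a (suc l) pr a<p p≤ with p ≤? 2 ^ (a + l)
  ... | yes p≤′ = ∈-++⁺ˡ (∈-dyadicPrimes a l pr a<p p≤′)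
  ... | no p≰ = ∈-++⁺ʳ (dyadicPrimes a l) (∈-primesIn _ pr (≰⇒> p≰)
          (subst (p ≤_) (trans (cong (2 ^_) (+-suc a l)) (2*m≡m+m (2 ^ (a + l)))) p≤))

  product⁻-++ : ∀ xs ys → product⁻ (xs ++ ys) ≡ product⁻ xs * product⁻ ys
  product⁻-++ xs ys = trans (cong product (map-++ pred xs ys)) (product-++ (map pred xs) (map pred ys))

  -- `telescope` bounds the ratio by 1 + count/N, and `chebyshev` turns this into 1 + 2/k.
  primesIn-ratio : ∀ k → let Q = primesIn (2 ^ k) (2 ^ k) in k * product Q ≤ (2 + k) * product⁻ Q
  primesIn-ratio k = *-cancelˡ-≤ N (begin
    N * (k * product Q)                ≡⟨ lemma N k (product Q) ⟩
    k * (N * product Q)                ≤⟨ *-monoʳ-≤ k (telescope prime? N N) ⟩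
    k * ((N + length Q) * product⁻ Q)  ≡⟨ lemma₂ k N (length Q) (product⁻ Q) ⟩
    (k * N + k * length Q) * product⁻ Q ≤⟨ *-monoˡ-≤ (product⁻ Q) (+-monoʳ-≤ (k * N) (chebyshev k)) ⟩
    (k * N + (N + N)) * product⁻ Q      ≡⟨ lemma₃ k N (product⁻ Q) ⟩
    N * ((2 + k) * product⁻ Q)          ∎)
    where
    open ≤-Reasoning
    N = 2 ^ k
    instance _ = m^n≢0 2 k
    Q = primesIn N N
    lemma : ∀ N k a → N * (k * a) ≡ k * (N * a)
    lemma = solve-∀
    lemma₂ : ∀ k N c b → k * ((N + c) * b) ≡ (k * N + k * c) * b
    lemma₂ = solve-∀
    lemma₃ : ∀ k N b → (k * N + (N + N)) * b ≡ N * ((2 + k) * b)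
    lemma₃ = solve-∀

  -- The factors (k + 2)/k for k = a, ..., a + l - 1 telescope in steps of two, which leaves two
  -- consecutive numbers at either end.
  dyadicPrimes-ratio : ∀ a l .{{_ : NonZero a}} → let Q = dyadicPrimes a l in
    a * suc a * product Q ≤ (a + l) * suc (a + l) * product⁻ Q
  dyadicPrimes-ratio a zero = ≤-reflexive (cong (λ m → m * suc m * 1) (sym (+-identityʳ a)))
  dyadicPrimes-ratio a@(suc _) (suc l) = *-cancelˡ-≤ k (begin
    k * (a * suc a * product (Q ++ q))        ≡⟨ cong (λ x → k * (a * suc a * x)) (product-++ Q q) ⟩
    k * (a * suc a * (product Q * product q)) ≡⟨ lemma k (a * suc a) (product Q) (product q) ⟩
    (a * suc a * product Q) * (k * product q) ≤⟨ *-mono-≤ (dyadicPrimes-ratio a l) (primesIn-ratio k) ⟩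
    (k * suc k * product⁻ Q) * ((2 + k) * product⁻ q) ≡⟨ lemma₂ k (product⁻ Q) (product⁻ q) ⟩
    k * (suc k * suc (suc k) * (product⁻ Q * product⁻ q))
      ≡⟨ cong₂ (λ x y → k * (x * suc x * y)) (+-suc a l) (product⁻-++ Q q) ⟨
    k * ((a + suc l) * suc (a + suc l) * product⁻ (Q ++ q)) ∎)
    where
    open ≤-Reasoning
    k = a + l
    Q = dyadicPrimes a l
    q = primesIn (2 ^ k) (2 ^ k)
    lemma : ∀ k a x y → k * (a * (x * y)) ≡ (a * x) * (k * y)
    lemma = solve-∀
    lemma₂ : ∀ k x y → (k * suc k * x) * ((2 + k) * y) ≡ k * (suc k * suc (suc k) * (x * y))
    lemma₂ = solve-∀

  -- For l = β a the bound no longer depends on a. Mertens' theorem would give the first power of β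
  -- + 1 up to a constant; the square is harmless because β will depend only on C.
  dyadicPrimes-ratio′ : ∀ a β .{{_ : NonZero a}} → let Q = dyadicPrimes a (β * a) in
    product Q ≤ suc β * suc β * product⁻ Q
  dyadicPrimes-ratio′ a@(suc _) β = *-cancelˡ-≤ (a * suc a) (begin
    a * suc a * product Q                    ≤⟨ dyadicPrimes-ratio a (β * a) ⟩
    (suc β * a) * suc (suc β * a) * product⁻ Q ≤⟨ m≤m+n _ _ ⟩
    (suc β * a) * suc (suc β * a) * product⁻ Q + suc β * a * β * product⁻ Q ≡⟨ lemma a β (product⁻ Q) ⟩
    a * suc a * (suc β * suc β * product⁻ Q) ∎)
    where
    open ≤-Reasoning
    Q = dyadicPrimes a (β * a)
    lemma : ∀ a β x → (suc β * a) * suc (suc β * a) * x + suc β * a * β * x ≡ a * suc a * (suc β * suc β * x)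
    lemma = solve-∀

  -- The tail of large prime factors of n

  largePrimes : ℕ → ℕ → List ℕ
  largePrimes θ n = filter (λ p → prime? p ×-dec p ∣? n) (interval θ n)

  largePrimes-prime : ∀ θ n → All Prime (largePrimes θ n)
  largePrimes-prime θ n = All.map proj₁ (AllP.all-filter _ (interval θ n))

  ∈-largePrimes : ∀ {p θ n} .{{_ : NonZero n}} → Prime p → p ∣ n → θ < p → p ∈ largePrimes θ n
  ∈-largePrimes {p} {θ} {n} pr p∣n θ<p = ∈-filter⁺ (λ p → prime? p ×-dec p ∣? n)
    (∈-interval⁺ n θ<p (≤-trans (∣⇒≤ p∣n) (m≤n+m n θ))) (pr , p∣n)

  -- The product of these primes divides n < 4^θ and each of them is at least 4, so there are fewer
  -- than θ. Then `telescope` bounds the ratio by (θ + θ)/θ.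
  largePrimes-ratio : ∀ θ n .{{_ : NonZero n}} → 4 ≤ θ → n < 4 ^ θ → let Q = largePrimes θ n in
    product Q ≤ 2 * product⁻ Q
  largePrimes-ratio θ n 4≤θ n< = *-cancelˡ-≤ θ {{>-nonZero (≤-trans (s≤s z≤n) 4≤θ)}} (begin
    θ * product Q               ≤⟨ telescope P? θ n ⟩
    (θ + length Q) * product⁻ Q ≤⟨ *-monoˡ-≤ (product⁻ Q) (+-monoʳ-≤ θ (<⇒≤ count)) ⟩
    (θ + θ) * product⁻ Q        ≡⟨ lemma θ (product⁻ Q) ⟩
    θ * (2 * product⁻ Q)        ∎)
    where
    open ≤-Reasoning
    P? = λ p → prime? p ×-dec p ∣? n
    Q = largePrimes θ n
    lemma : ∀ t x → (t + t) * x ≡ t * (2 * x)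
    lemma = solve-∀
    4≤Q : All (4 ≤_) Q
    4≤Q = All.map (λ θ<q → ≤-trans 4≤θ (<⇒≤ θ<q)) (All-filter P? (interval> θ n))
    count : length Q < θ
    count = ^-cancelʳ-< 4 (s≤s (s≤s z≤n)) (≤-<-trans (^length≤product 4≤Q)
      (≤-<-trans (∣⇒≤ (product-∣ (Unique.filter⁺ P? (interval-unique θ n)) (largePrimes-prime θ n)
        (All.map proj₂ (AllP.all-filter P? (interval θ n))))) n<))

  -- The bound for σ over one class

  prime≤4 : ∀ {p} → Prime p → p ≤ 4 → p ≡ 2 ⊎ p ≡ 3
  prime≤4 {0} pr _ = contradiction pr ¬prime[0]
  prime≤4 {1} pr _ = contradiction pr ¬prime[1]
  prime≤4 {2} pr _ = inj₁ refl
  prime≤4 {3} pr _ = inj₂ refl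
  prime≤4 {4} pr _ = contradiction pr (composite⇒¬prime composite[4])
  prime≤4 {suc (suc (suc (suc (suc _))))} pr (s≤s (s≤s (s≤s (s≤s ()))))

  prime[3] : Prime 3
  prime[3] = from-yes (prime? 3)

  product⁻≢0 : ∀ {Q} → All Prime Q → NonZero (product⁻ Q)
  product⁻≢0 [] = _
  product⁻≢0 {suc zero ∷ Q} (pr ∷ _) = contradiction pr ¬prime[1]
  product⁻≢0 {zero ∷ Q} (pr ∷ _) = contradiction pr ¬prime[0]
  product⁻≢0 {suc (suc q) ∷ Q} (_ ∷ Q-pr) = m*n≢0 (suc q) (product⁻ Q) {{_}} {{product⁻≢0 Q-pr}}

  σ≤ : ∀ K {Q fs} → All Prime Q → All Prime fs → fs ⊆ Q →
    product Q ≤ K * product⁻ Q → σ (product fs) ≤ K * product fs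
  σ≤ K {Q} {fs} Q-pr fs-pr s le = *-cancelʳ-≤ _ _ (product⁻ Q) {{product⁻≢0 Q-pr}} (begin
    σ (product fs) * product⁻ Q   ≤⟨ σ-smooth Q Q-pr fs-pr s ⟩
    product fs * product Q        ≤⟨ *-monoʳ-≤ (product fs) le ⟩
    product fs * (K * product⁻ Q) ≡⟨ lemma (product fs) K (product⁻ Q) ⟩
    K * product fs * product⁻ Q   ∎)
    where
    open ≤-Reasoning
    lemma : ∀ a b c → a * (b * c) ≡ b * a * c
    lemma = solve-∀

  module _ {n : ℕ} .{{_ : NonZero n}} (a β : ℕ) .{{_ : NonZero a}} where

    -- The lowest class boundary is 4, so 2 and 3 lie below every dyadic range and are listed
    -- separately. `X` is empty for a bounded class and the tail of large primes for the last one.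
    classPrimes : List ℕ → List ℕ
    classPrimes X = 2 ∷ 3 ∷ dyadicPrimes a (β * a) ++ X

    -- The constant 6 is 2/1 · 3/2 for the primes 2 and 3, times 2 for `X`.
    classPrimes-ratio : ∀ X → product X ≤ 2 * product⁻ X →
      product (classPrimes X) ≤ 6 * (suc β * suc β) * product⁻ (classPrimes X)
    classPrimes-ratio X le = begin
      2 * (3 * product (D ++ X))       ≡⟨ cong (λ x → 2 * (3 * x)) (product-++ D X) ⟩
      2 * (3 * (product D * product X)) ≤⟨ *-monoʳ-≤ 2 (*-monoʳ-≤ 3 (*-mono-≤ (dyadicPrimes-ratio′ a β) le)) ⟩
      2 * (3 * (suc β * suc β * product⁻ D * (2 * product⁻ X))) ≡⟨ lemma (suc β * suc β) (product⁻ D) (product⁻ X) ⟩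
      6 * (suc β * suc β) * (1 * (2 * (product⁻ D * product⁻ X))) ≡⟨ cong (λ x → 6 * (suc β * suc β) * (1 * (2 * x))) (product⁻-++ D X) ⟨
      6 * (suc β * suc β) * (1 * (2 * product⁻ (D ++ X))) ∎
      where
      open ≤-Reasoning
      D = dyadicPrimes a (β * a)
      lemma : ∀ b x y → 2 * (3 * (b * x * (2 * y))) ≡ 6 * b * (1 * (2 * (x * y)))
      lemma = solve-∀

    -- The unbounded class is a bounded range followed by a tail. Divisibility of n by `product fs`
    -- places the large primes in that tail.
    σ-class : ∀ {fs} → All Prime fs → product fs ∣ n →
      All (λ p → p ≤ 4 ⊎ 2 ^ a < p) fs →
      All (_≤ 2 ^ (suc β * a)) fs ⊎ (4 ≤ 2 ^ (suc β * a) × n < 4 ^ 2 ^ (suc β * a)) →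
      σ (product fs) ≤ 6 * (suc β * suc β) * product fs
    σ-class {fs} fs-pr fs∣n low (inj₁ high) = σ≤ (6 * (suc β * suc β)) {classPrimes []}
      (prime[2] ∷ prime[3] ∷ AllP.++⁺ (dyadicPrimes-prime a (β * a)) []) fs-pr sub (classPrimes-ratio [] (s≤s z≤n))
      where
      sub : fs ⊆ classPrimes []
      sub {x} x∈ with All.lookup low x∈
      ... | inj₂ a<x = there (there (∈-++⁺ˡ (∈-dyadicPrimes a (β * a) (All.lookup fs-pr x∈) a<x (All.lookup high x∈))))
      ... | inj₁ x≤4 with prime≤4 (All.lookup fs-pr x∈) x≤4
      ...   | inj₁ eq = here eq
      ...   | inj₂ eq = there (here eq)
    σ-class {fs} fs-pr fs∣n low (inj₂ (4≤ , n<)) = σ≤ (6 * (suc β * suc β)) {classPrimes X}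
      (prime[2] ∷ prime[3] ∷ AllP.++⁺ (dyadicPrimes-prime a (β * a)) (largePrimes-prime θ n)) fs-pr sub
      (classPrimes-ratio X (largePrimes-ratio θ n 4≤ n<))
      where
      θ = 2 ^ (suc β * a)
      X = largePrimes θ n
      sub : fs ⊆ classPrimes X
      sub {x} x∈ with All.lookup low x∈ | x ≤? θ
      ... | _ | no x≰ = there (there (∈-++⁺ʳ (dyadicPrimes a (β * a))
              (∈-largePrimes (All.lookup fs-pr x∈) (∣-trans (∈⇒∣product x∈) fs∣n) (≰⇒> x≰))))
      ... | inj₂ a<x | yes x≤ = there (there (∈-++⁺ˡ (∈-dyadicPrimes a (β * a) (All.lookup fs-pr x∈) a<x x≤)))
      ... | inj₁ x≤4 | yes _ with prime≤4 (All.lookup fs-pr x∈) x≤4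
      ...   | inj₁ eq = here eq
      ...   | inj₂ eq = there (here eq)

  -- Locating a number between consecutive values; growth of powers

  bracket : (f : ℕ → ℕ) → (∀ k → k < f k) → ∀ x → ∃[ h ] x < f (suc h) × (h ≡ 0 ⊎ f h ≤ x)
  -- The search runs downwards from h = x, where the upper inequality is sure to hold. It stops once
  -- the lower one holds, or at h = 0, where the lower one is left open.
  bracket f k<fk x = search x (<-trans (n<1+n x) (k<fk (suc x)))
    where
    search : ∀ k → x < f (suc k) → ∃[ h ] x < f (suc h) × (h ≡ 0 ⊎ f h ≤ x)
    search zero lt = 0 , lt , inj₁ refl
    search (suc k) lt with f (suc k) ≤? x
    ... | yes le = suc k , lt , inj₂ le
    ... | no nle = search k (≰⇒> nle)

  n<2^n : ∀ n → n < 2 ^ n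
  n<2^n zero = s≤s z≤n
  n<2^n (suc n) = begin-strict
    suc n         ≤⟨ n<2^n n ⟩
    2 ^ n         <⟨ ^-monoʳ-< 2 (s≤s (s≤s z≤n)) (n<1+n n) ⟩
    2 ^ suc n     ∎
    where open ≤-Reasoning

  n<4^n : ∀ n → n < 4 ^ n
  n<4^n n = <-≤-trans (n<2^n n) (^-monoˡ-≤ n (s≤s (s≤s z≤n)))

  s*[1+s]≤2*2^s : ∀ s → s * suc s ≤ 2 * 2 ^ s
  s*[1+s]≤2*2^s zero = z≤n
  s*[1+s]≤2*2^s (suc s) = begin
    suc s * suc (suc s)         ≡⟨ lemma s ⟩
    s * suc s + 2 * suc s       ≤⟨ +-mono-≤ (s*[1+s]≤2*2^s s) (*-monoʳ-≤ 2 (n<2^n s)) ⟩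
    2 * 2 ^ s + 2 * 2 ^ s       ≡⟨ 2*m≡m+m (2 * 2 ^ s) ⟨
    2 * 2 ^ suc s               ∎
    where
    open ≤-Reasoning
    lemma : ∀ s → suc s * suc (suc s) ≡ s * suc s + 2 * suc s
    lemma = solve-∀

  4^n≡2^[2*n] : ∀ n → 4 ^ n ≡ 2 ^ (2 * n)
  4^n≡2^[2*n] = ^-*-assoc 2 2

  -- The general bound log d(m) = O(log m / log log m)

  prime≥2 : ∀ {p} → Prime p → 2 ≤ p
  prime≥2 pr = nonTrivial⇒n>1 _ {{prime⇒nonTrivial pr}}

  d-prime : ∀ {p} → Prime p → d (p * 1) ≤ 2
  d-prime pr = d-prime^ pr 1

  d≤2^length : ∀ {fs} → All Prime fs → d (product fs) ≤ 2 ^ length fs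
  d≤2^length [] = ≤-refl
  d≤2^length {p ∷ fs} (pr ∷ prs) = ≤-trans (d-* p (product fs))
    (*-mono-≤ (subst (λ x → d x ≤ 2) (*-identityʳ p) (d-prime pr)) (d≤2^length prs))
    where
    instance
      _ = prime⇒nonZero pr
      _ = productOfPrimes≢0 prs

  -- Cut the primes at y = 2^s, about the square root of L. Those up to y give at most (L + 1)^y ≤
  -- 2^(2 (s + 1) y) divisors. Of those above y there are at most L/s with multiplicity, each at
  -- most doubling the count. Since s (s + 1) ≤ 2 y and y² = 4^s ≤ L, the first part costs 4 L and
  -- the second L after multiplication by s.
  d≤2^ : ∀ L s {fs} → All Prime fs → product fs ≤ 2 ^ L → 4 ^ s ≤ L → L < 4 ^ suc s →
    ∃[ E ] d (product fs) ≤ 2 ^ E × s * E ≤ 5 * L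
  d≤2^ L s {fs} prs fs≤ s≤ <s = 2 * suc s * y + length fs₂ , d≤ , (begin
    s * (2 * suc s * y + length fs₂)       ≡⟨ lemma s y (length fs₂) ⟩
    2 * (s * suc s) * y + s * length fs₂   ≤⟨ +-mono-≤ (*-monoˡ-≤ y (*-monoʳ-≤ 2 (s*[1+s]≤2*2^s s))) large ⟩
    2 * (2 * y) * y + L                    ≡⟨ cong (_+ L) (lemma₂ y) ⟩
    4 * (y * y) + L                        ≡⟨ cong (λ x → 4 * x + L) y² ⟩
    4 * 4 ^ s + L                          ≤⟨ +-monoˡ-≤ L (*-monoʳ-≤ 4 s≤) ⟩
    4 * L + L                              ≡⟨ +-comm (4 * L) L ⟩
    5 * L                                  ∎)
    where
    open ≤-Reasoning
    y = 2 ^ s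
    fs₁ = filter (_≤? y) fs
    fs₂ = filter (∁? (_≤? y)) fs
    prs₁ = All-filter (_≤? y) prs
    prs₂ = All-filter (∁? (_≤? y)) prs
    instance
      _ = productOfPrimes≢0 prs₁
      _ = productOfPrimes≢0 prs₂
    split : product fs ≡ product fs₁ * product fs₂
    split = product-filter (_≤? y) fs
    lemma : ∀ s y l → s * (2 * suc s * y + l) ≡ 2 * (s * suc s) * y + s * l
    lemma = solve-∀
    lemma₂ : ∀ y → 2 * (2 * y) * y ≡ 4 * (y * y)
    lemma₂ = solve-∀
    y² : y * y ≡ 4 ^ s
    y² = trans (sym (^-distribˡ-+-* 2 s s)) (trans (cong (2 ^_) (sym (2*m≡m+m s))) (sym (4^n≡2^[2*n] s)))
    length≤L : length fs ≤ L
    length≤L = ^-cancelʳ-≤ 2 ≤-refl (≤-trans (^length≤product (All.map prime≥2 prs)) fs≤)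
    large : s * length fs₂ ≤ L
    large = ^-cancelʳ-≤ 2 ≤-refl (begin
      2 ^ (s * length fs₂)       ≡⟨ ^-*-assoc 2 s (length fs₂) ⟨
      y ^ length fs₂             ≤⟨ ^length≤product (All.map (<⇒≤ ∘ ≰⇒>) (AllP.all-filter (∁? (_≤? y)) fs)) ⟩
      product fs₂                ≤⟨ m≤n*m (product fs₂) (product fs₁) ⟩
      product fs₁ * product fs₂  ≡⟨ split ⟨
      product fs                 ≤⟨ fs≤ ⟩
      2 ^ L                      ∎)
    smooth : fs₁ ⊆ primesIn 0 y
    smooth x∈ with ∈-filter⁻ (_≤? y) {xs = fs} x∈
    ... | x∈fs , x≤y = ∈-primesIn y pr (<-trans (s≤s z≤n) (prime≥2 pr)) x≤y
      where pr = All.lookup prs x∈fs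
    small : d (product fs₁) ≤ 2 ^ (2 * suc s * y)
    small = begin
      d (product fs₁)                  ≤⟨ d-smooth L (primesIn 0 y) (primesIn-prime 0 y) prs₁ smooth
                                            (≤-trans (length-filter (_≤? y) fs) length≤L) ⟩
      suc L ^ length (primesIn 0 y)    ≤⟨ ^-monoʳ-≤ (suc L) (≤-trans (length-filter prime? (interval 0 y))
                                            (≤-reflexive (length-interval 0 y))) ⟩
      suc L ^ y                        ≤⟨ ^-monoˡ-≤ y <s ⟩
      (4 ^ suc s) ^ y                  ≡⟨ cong (_^ y) (4^n≡2^[2*n] (suc s)) ⟩
      (2 ^ (2 * suc s)) ^ y            ≡⟨ ^-*-assoc 2 (2 * suc s) y ⟩
      2 ^ (2 * suc s * y)              ∎
    d≤ : d (product fs) ≤ 2 ^ (2 * suc s * y + length fs₂)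
    d≤ = begin
      d (product fs)                         ≡⟨ cong d split ⟩
      d (product fs₁ * product fs₂)          ≤⟨ d-* (product fs₁) (product fs₂) ⟩
      d (product fs₁) * d (product fs₂)      ≤⟨ *-mono-≤ small (d≤2^length prs₂) ⟩
      2 ^ (2 * suc s * y) * 2 ^ length fs₂   ≡⟨ ^-distribˡ-+-* 2 (2 * suc s * y) (length fs₂) ⟨
      2 ^ (2 * suc s * y + length fs₂)       ∎

  -- Selecting a class and a divisor composed of its primes

  Singleton : List ℕ → Set
  Singleton T = ∃[ p ] T ≡ p ∷ []

  -- If dropping a factor leaves less than R, the product is at most R² unless that factor is
  -- itself at least R, in which case it is used alone.
  greedy : ∀ {R} fs → 1 ≤ R → R ≤ product fs → ∃[ T ] T ⊆ fs × product T ∣ product fs ×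
    R ≤ product T × (Singleton T ⊎ product T ≤ R * R)
  greedy [] 1≤R R≤ = [] , id , ∣-refl , R≤ , inj₂ (*-mono-≤ 1≤R 1≤R)
  greedy {R} (p ∷ fs) 1≤R R≤ with R ≤? product fs
  ... | yes R≤fs with greedy fs 1≤R R≤fs
  ...   | T , T⊆ , T∣ , R≤T , small = T , there ∘ T⊆ , ∣-trans T∣ (n∣m*n p) , R≤T , small
  greedy {R} (p ∷ fs) 1≤R R≤ | no R≰fs with R ≤? p
  ... | yes R≤p = p ∷ [] , (λ { (here eq) → here eq }) ,
          subst (_∣ p * product fs) (sym (*-identityʳ p)) (m∣m*n (product fs)) ,
          subst (R ≤_) (sym (*-identityʳ p)) R≤p , inj₁ (p , refl)
  ... | no R≰p = p ∷ fs , id , ∣-refl , R≤ , inj₂ (*-mono-≤ (<⇒≤ (≰⇒> R≰p)) (<⇒≤ (≰⇒> R≰fs)))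

  -- Split off the primes above the highest boundary. Either their product reaches R, or dropping
  -- them costs a factor less than R, and enough is left for one class fewer.
  pigeonhole : ∀ (θ : ℕ → ℕ) {R} → 1 ≤ R → ∀ G fs → R ^ suc G ≤ product fs →
    ∃₂ λ g S → S ⊆ fs × product S ∣ product fs × R ≤ product S ×
      (g ≡ 0 ⊎ All (θ g <_) S) × (All (_≤ θ (suc g)) S ⊎ g ≡ G)
  pigeonhole θ {R} 1≤R zero fs R≤ = 0 , fs , id , ∣-refl , subst (_≤ product fs) (*-identityʳ R) R≤ , inj₁ refl , inj₂ refl
  pigeonhole θ {R} 1≤R (suc G) fs R≤ with R ≤? product (filter (∁? (_≤? θ (suc G))) fs)
  ... | yes R≤big = suc G , big , (proj₁ ∘ ∈-filter⁻ (∁? P?) {xs = fs}) ,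
          divides (product (filter P? fs)) (product-filter P? fs) ,
          R≤big , inj₂ (All.map ≰⇒> (AllP.all-filter (∁? P?) fs)) , inj₂ refl
    where
    P? = _≤? θ (suc G)
    big = filter (∁? P?) fs
  ... | no R≰big = pack (pigeonhole θ 1≤R G small (*-cancelˡ-≤ R {{>-nonZero 1≤R}} (begin
      R * R ^ suc G              ≤⟨ R≤ ⟩
      product fs                 ≡⟨ product-filter P? fs ⟩
      product small * product big ≤⟨ *-monoʳ-≤ (product small) (<⇒≤ (≰⇒> R≰big)) ⟩
      product small * R          ≡⟨ *-comm (product small) R ⟩
      R * product small          ∎)))
    where
    open ≤-Reasoning
    P? = _≤? θ (suc G)
    big = filter (∁? P?) fs
    small = filter P? fs
    small∣ : product small ∣ product fs
    small∣ = divides (product big) (trans (product-filter P? fs) (*-comm (product small) (product big)))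
    pack : (∃₂ λ g S → S ⊆ small × product S ∣ product small × R ≤ product S ×
        (g ≡ 0 ⊎ All (θ g <_) S) × (All (_≤ θ (suc g)) S ⊎ g ≡ G)) →
      ∃₂ λ g S → S ⊆ fs × product S ∣ product fs × R ≤ product S ×
        (g ≡ 0 ⊎ All (θ g <_) S) × (All (_≤ θ (suc g)) S ⊎ g ≡ suc G)
    pack (g , S , S⊆ , S∣ , R≤S , low , high) =
      g , S , proj₁ ∘ ∈-filter⁻ P? {xs = fs} ∘ S⊆ , ∣-trans S∣ small∣ , R≤S , low , inj₁ (bound high)
      where
      bound : All (_≤ θ (suc g)) S ⊎ g ≡ G → All (_≤ θ (suc g)) S
      bound (inj₁ a) = a
      -- The top class of the recursive call is unbounded there, but all its primes come from
      -- `small`, which is cut off at θ (suc G).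
      bound (inj₂ refl) = All.tabulate λ x∈ → proj₂ (∈-filter⁻ P? {xs = fs} (S⊆ x∈))

  module _ (β : ℕ) where

    -- Binary logarithms of the class boundaries: class g consists of the primes between 2^(κ g) and
    -- 2^(κ (g + 1)), so log p varies by a factor β + 1.
    κ : ℕ → ℕ
    κ zero    = 2
    κ (suc g) = suc β * κ g

    κ≥2 : ∀ g → 2 ≤ κ g
    κ≥2 zero = ≤-refl
    κ≥2 (suc g) = ≤-trans (κ≥2 g) (m≤m+n (κ g) (β * κ g))

    divisor-σ : ∀ {n R} G .{{_ : NonZero n}} → 1 ≤ R → n < 4 ^ 2 ^ κ (suc G) → R ^ suc G ≤ n →
      ∃[ T ] All Prime T × product T ∣ n × R ≤ product T × (Singleton T ⊎ product T ≤ R * R) ×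
        σ (product T) ≤ 6 * (suc β * suc β) * product T
    divisor-σ {n} {R} G 1≤R n< R^≤n
      with pigeonhole (λ g → 2 ^ κ g) 1≤R G factors (subst (R ^ suc G ≤_) isFactorisation R^≤n)
      where open PrimeFactorisation (factorise n)
    ... | g , S , S⊆ , S∣ , R≤S , low , high with greedy S 1≤R R≤S
    ...   | T , T⊆ , T∣ , R≤T , small =
      T , T-prime , T∣n , R≤T , small ,
      σ-class (κ g) β {{>-nonZero (<-≤-trans (s≤s z≤n) (κ≥2 g))}} T-prime T∣n (All.tabulate (low′ low ∘ T⊆)) (high′ high)
      where
      open PrimeFactorisation (factorise n)
      T-prime : All Prime T
      T-prime = All.tabulate λ x∈ → All.lookup factorsPrime (S⊆ (T⊆ x∈))
      T∣n : product T ∣ n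
      T∣n = subst (product T ∣_) (sym isFactorisation) (∣-trans T∣ S∣)
      low′ : g ≡ 0 ⊎ All (2 ^ κ g <_) S → ∀ {p} → p ∈ S → p ≤ 4 ⊎ 2 ^ κ g < p
      low′ (inj₂ a) p∈ = inj₂ (All.lookup a p∈)
      -- Class 0 has no lower boundary; since 2^(κ 0) = 4, its primes are 2, 3 or above the
      -- boundary.
      low′ (inj₁ refl) {p} p∈ with p ≤? 4
      ... | yes p≤4 = inj₁ p≤4
      ... | no p≰4 = inj₂ (≰⇒> p≰4)
      high′ : All (_≤ 2 ^ κ (suc g)) S ⊎ g ≡ G → All (_≤ 2 ^ κ (suc g)) T ⊎ (4 ≤ 2 ^ κ (suc g) × n < 4 ^ 2 ^ κ (suc g))
      high′ (inj₁ a) = inj₁ (All.tabulate (All.lookup a ∘ T⊆))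
      high′ (inj₂ refl) = inj₂ (^-monoʳ-≤ 2 (κ≥2 (suc G)) , n<)

  -- A single prime can be far larger than R², but it has only two divisors, so E = 1 works.
  -- Otherwise the product is at most R² < 2^(4 (h + 1)), and `d≤2^` applies with L = 4 (h + 1).
  d-small : ∀ {R T} h s → All Prime T → Singleton T ⊎ product T ≤ R * R → R < 4 ^ suc h →
    4 ^ s ≤ 4 * suc h → 4 * suc h < 4 ^ suc s → ∃[ E ] d (product T) ≤ 2 ^ E × s * E ≤ 5 * (4 * suc h)
  d-small h s (pr ∷ []) (inj₁ (p , refl)) _ s≤ _ = 1 , d-prime pr ,
    ≤-trans (≤-reflexive (*-identityʳ s)) (≤-trans (<⇒≤ (n<4^n s)) (≤-trans s≤ (m≤n*m (4 * suc h) 5)))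
  d-small {R} {T} h s prs (inj₂ T≤) R< s≤ <s = d≤2^ (4 * suc h) s prs (begin
    product T                 ≤⟨ T≤ ⟩
    R * R                     ≤⟨ *-mono-≤ (<⇒≤ R<) (<⇒≤ R<) ⟩
    4 ^ suc h * 4 ^ suc h     ≡⟨ ^-distribˡ-+-* 4 (suc h) (suc h) ⟨
    4 ^ (suc h + suc h)       ≡⟨ 4^n≡2^[2*n] (suc h + suc h) ⟩
    2 ^ (2 * (suc h + suc h)) ≡⟨ cong (2 ^_) (lemma (suc h)) ⟩
    2 ^ (4 * suc h)           ∎) s≤ <s
    where
    open ≤-Reasoning
    lemma : ∀ h → 2 * (h + h) ≡ 4 * h
    lemma = solve-∀

  -- Everything is a power of 4 because exp k ≤ 4 ^ k, so that 4 ^ 4 ^ 4 ^ j ≤ n yields j ≤ log log log n.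
  module Thresholds (b : ℕ) where

    β : ℕ
    β = pred (4 ^ b)

    1+β≡4^b : suc β ≡ 4 ^ b
    1+β≡4^b = suc-pred (4 ^ b) {{m^n≢0 4 b}}

    -- 4 to the power of a class boundary, as in `largePrimes-ratio`: the G with threshold G ≤ n <
    -- threshold (G + 1) is the index at which the class can be left unbounded.
    threshold : ℕ → ℕ
    threshold g = 4 ^ 2 ^ κ β g

    -- The initial value κ 0 = 2 turns every boundary 2^(κ g) into 4^(4^(b g)), which makes the
    -- thresholds towers of 4.
    κ≡2*4^[b*g] : ∀ g → κ β g ≡ 2 * 4 ^ (b * g)
    κ≡2*4^[b*g] zero = cong (λ x → 2 * 4 ^ x) (sym (*-zeroʳ b))
    κ≡2*4^[b*g] (suc g) = begin
      suc β * κ β g            ≡⟨ cong (_* κ β g) 1+β≡4^b ⟩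
      4 ^ b * κ β g            ≡⟨ cong (4 ^ b *_) (κ≡2*4^[b*g] g) ⟩
      4 ^ b * (2 * 4 ^ (b * g)) ≡⟨ lemma (4 ^ b) (4 ^ (b * g)) ⟩
      2 * (4 ^ b * 4 ^ (b * g)) ≡⟨ cong (2 *_) (^-distribˡ-+-* 4 b (b * g)) ⟨
      2 * 4 ^ (b + b * g)      ≡⟨ cong (λ x → 2 * 4 ^ x) (*-suc b g) ⟨
      2 * 4 ^ (b * suc g)      ∎
      where
      open ≡-Reasoning
      lemma : ∀ x y → x * (2 * y) ≡ 2 * (x * y)
      lemma = solve-∀

    threshold≡ : ∀ g → threshold g ≡ 4 ^ 4 ^ 4 ^ (b * g)
    threshold≡ g = cong (4 ^_) (trans (cong (2 ^_) (κ≡2*4^[b*g] g)) (sym (4^n≡2^[2*n] (4 ^ (b * g)))))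

    4*[1+g]≤4^4^[b*g] : .{{_ : NonZero b}} → ∀ g → 4 * suc g ≤ 4 ^ 4 ^ (b * g)
    4*[1+g]≤4^4^[b*g] g = begin
      4 * suc g       ≤⟨ *-monoʳ-≤ 4 (n<4^n g) ⟩
      4 ^ suc g       ≤⟨ ^-monoʳ-≤ 4 (≤-trans (n<4^n g) (^-monoʳ-≤ 4 (m≤n*m g b))) ⟩
      4 ^ 4 ^ (b * g) ∎
      where open ≤-Reasoning

    n<threshold : .{{_ : NonZero b}} → ∀ g → g < threshold g
    n<threshold g = begin-strict
      g               <⟨ n<1+n g ⟩
      suc g           ≤⟨ m≤n*m (suc g) 4 ⟩
      4 * suc g       ≤⟨ 4*[1+g]≤4^4^[b*g] g ⟩
      4 ^ 4 ^ (b * g) <⟨ n<4^n _ ⟩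
      4 ^ 4 ^ 4 ^ (b * g) ≡⟨ threshold≡ g ⟨
      threshold g     ∎
      where open ≤-Reasoning

    -- 4 ^ (4 (g + 1)) ≤ n absorbs the loss from replacing r by R ≤ 4 r.
    halve-exponent : ∀ {R n} .{{_ : NonZero b}} g → threshold g ≤ n →
      R ^ (2 * suc g) ≤ 4 ^ (2 * suc g * 2) * n → R ^ suc g ≤ n
    halve-exponent {R} {n} g θ≤n le = ≮⇒≥ λ n<R → <⇒≱ (*-mono-< n<R n<R) (begin
      R ^ suc g * R ^ suc g           ≡⟨ ^-distribˡ-+-* R (suc g) (suc g) ⟨
      R ^ (suc g + suc g)             ≡⟨ cong (R ^_) (2*m≡m+m (suc g)) ⟨
      R ^ (2 * suc g)                 ≤⟨ le ⟩
      4 ^ (2 * suc g * 2) * n         ≡⟨ cong (λ x → 4 ^ x * n) (lemma (suc g)) ⟩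
      4 ^ (4 * suc g) * n             ≤⟨ *-monoˡ-≤ n (≤-trans (^-monoʳ-≤ 4 (4*[1+g]≤4^4^[b*g] g))
                                           (≤-trans (≤-reflexive (sym (threshold≡ g))) θ≤n)) ⟩
      n * n                           ∎)
      where
      open ≤-Reasoning
      lemma : ∀ x → 2 * x * 2 ≡ 4 * x
      lemma = solve-∀

  -- The source of the factor 4 in b = 4 (c + 1): one 2 is the spare factor in the exponent, the
  -- other comes from g + 1 ≤ 2 g.
  2*[1+g]*c≤4*c*g : ∀ c g .{{_ : NonZero g}} → 2 * suc g * c ≤ 4 * c * g
  2*[1+g]*c≤4*c*g c (suc g) = begin
    2 * suc (suc g) * c              ≤⟨ m≤m+n _ (2 * (g * c)) ⟩
    2 * suc (suc g) * c + 2 * (g * c) ≡⟨ lemma c g ⟩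
    4 * c * suc g                    ∎
    where
    open ≤-Reasoning
    lemma : ∀ c g → 2 * suc (suc g) * c + 2 * (g * c) ≡ 4 * c * suc g
    lemma = solve-∀

-- Ordered field arithmetic and the embedding of ℕ

module RealAnalysis {c ℓ₁ ℓ₂ : Level} (ℛ : Reals c ℓ₁ ℓ₂) where
  open Reals ℛ
  open GroupProperties +-group using (\\-leftDividesˡ; \\-leftDividesʳ)
  open MonoidMult +-monoid using (×-homo-+)
  open SemiringMult semiring using (×1-homo-*)

  ≤-reflexive : ∀ {x y} → x ≈ y → x ≤ y
  ≤-reflexive x≈y y<x = <-irrefl (sym x≈y) y<x

  ≤-trans : ∀ {x y z} → x ≤ y → y ≤ z → x ≤ z
  ≤-trans {y = y} x≤y y≤z z<x with <-cotrans z<x y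
  ... | inj₁ z<y = y≤z z<y
  ... | inj₂ y<x = x≤y y<x

  <⇒≤ : ∀ {x y} → x < y → x ≤ y
  <⇒≤ x<y y<x = <-asym x<y y<x

  <-≤-trans : ∀ {x y z} → x < y → y ≤ z → x < z
  <-≤-trans {z = z} x<y y≤z with <-cotrans x<y z
  ... | inj₁ x<z = x<z
  ... | inj₂ z<y = contradiction z<y y≤z

  ≤-poset : Poset c ℓ₁ ℓ₂
  ≤-poset = record
    { Carrier = ℝ ; _≈_ = _≈_ ; _≤_ = _≤_
    ; isPartialOrder = record
      { isPreorder = record { isEquivalence = isEquivalence ; reflexive = ≤-reflexive ; trans = ≤-trans }
      ; antisym = ≤-antisym } }

  open import Relation.Binary.Reasoning.PartialOrder ≤-poset
    using (begin_; step-≤; step-≈-⟩; step-≈-⟨; _∎; begin-equality_)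

  ≤-refl : ∀ {x} → x ≤ x
  ≤-refl = ≤-reflexive refl

  -- Inequalities are negations, so they may be proved by cases on the order.
  <-tri : ∀ x y → ¬ ¬ (x < y ⊎ x ≈ y ⊎ y < x)
  <-tri x y k = k (inj₂ (inj₁ (≤-antisym (λ y<x → k (inj₂ (inj₂ y<x))) (λ x<y → k (inj₁ x<y)))))

  +-monoʳ-≤ : ∀ x {y z} → y ≤ z → x + y ≤ x + z
  +-monoʳ-≤ x {y} {z} y≤z lt = y≤z (<-respˡ-≈ (\\-leftDividesʳ x z) (<-respʳ-≈ (\\-leftDividesʳ x y) (+-monoʳ-< (- x) lt)))

  +-mono-≤ : ∀ {x y u v} → x ≤ y → u ≤ v → x + u ≤ y + v
  +-mono-≤ {x} {y} {u} {v} x≤y u≤v = begin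
    x + u ≤⟨ +-monoʳ-≤ x u≤v ⟩
    x + v ≈⟨ +-comm x v ⟩
    v + x ≤⟨ +-monoʳ-≤ v x≤y ⟩
    v + y ≈⟨ +-comm v y ⟩
    y + v ∎

  x<y⇒0<-x+y : ∀ {x y} → x < y → 0# < - x + y
  x<y⇒0<-x+y {x} x<y = <-respˡ-≈ (-‿inverseˡ x) (+-monoʳ-< (- x) x<y)

  *-monoʳ-< : ∀ {x y z} → 0# < x → y < z → x * y < x * z
  *-monoʳ-< {x} {y} {z} 0<x y<z = <-respˡ-≈ (+-identityʳ (x * y)) (<-respʳ-≈ eq
    (+-monoʳ-< (x * y) (*-pos 0<x (x<y⇒0<-x+y y<z))))
    where
    eq : x * y + x * (- y + z) ≈ x * z
    eq = trans (sym (distribˡ x y (- y + z))) (*-congˡ (\\-leftDividesˡ y z))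

  *-monoʳ-≤ : ∀ {x y z} → 0# ≤ x → y ≤ z → x * y ≤ x * z
  *-monoʳ-≤ {x} {y} {z} 0≤x y≤z xz<xy = <-tri 0# x λ
    { (inj₁ 0<x) → <-tri y z λ
      { (inj₁ y<z) → <-asym xz<xy (*-monoʳ-< 0<x y<z)
      ; (inj₂ (inj₁ y≈z)) → <-irrefl (*-congˡ (sym y≈z)) xz<xy
      ; (inj₂ (inj₂ z<y)) → y≤z z<y }
    ; (inj₂ (inj₁ 0≈x)) → <-irrefl (trans (zero-* 0≈x z) (sym (zero-* 0≈x y))) xz<xy
    ; (inj₂ (inj₂ x<0)) → 0≤x x<0 }
    where
    zero-* : 0# ≈ x → ∀ y → x * y ≈ 0#
    zero-* 0≈x y = trans (*-congʳ (sym 0≈x)) (zeroˡ y)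

  *-monoˡ-≤ : ∀ {x y z} → 0# ≤ x → y ≤ z → y * x ≤ z * x
  *-monoˡ-≤ {x} {y} {z} 0≤x y≤z = begin
    y * x ≈⟨ *-comm y x ⟩
    x * y ≤⟨ *-monoʳ-≤ 0≤x y≤z ⟩
    x * z ≈⟨ *-comm x z ⟩
    z * x ∎

  *-mono-≤ : ∀ {x y u v} → 0# ≤ x → 0# ≤ v → x ≤ y → u ≤ v → x * u ≤ y * v
  *-mono-≤ 0≤x 0≤v x≤y u≤v = ≤-trans (*-monoʳ-≤ 0≤x u≤v) (*-monoˡ-≤ 0≤v x≤y)

  *-cancelˡ-≤ : ∀ {x y z} → 0# < x → x * y ≤ x * z → y ≤ z
  *-cancelˡ-≤ 0<x le z<y = le (*-monoʳ-< 0<x z<y)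

  *-recip : ∀ x y → proj₁ x * (y / x) ≈ y
  *-recip x y = begin-equality
    proj₁ x * (y * recip x) ≈⟨ *-congˡ (*-comm y (recip x)) ⟩
    proj₁ x * (recip x * y) ≈⟨ *-assoc (proj₁ x) (recip x) y ⟨
    proj₁ x * recip x * y   ≈⟨ *-congʳ (*-inverseʳ x) ⟩
    1# * y                  ≈⟨ *-identityˡ y ⟩
    y                       ∎

  fromℕ-+ : ∀ m n → fromℕ (m ℕ.+ n) ≈ fromℕ m + fromℕ n
  fromℕ-+ = ×-homo-+ 1#

  fromℕ-* : ∀ m n → fromℕ (m ℕ.* n) ≈ fromℕ m * fromℕ n
  fromℕ-* = ×1-homo-*

  fromℕ-1 : fromℕ 1 ≈ 1#
  fromℕ-1 = +-identityʳ 1#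

  0≤fromℕ : ∀ n → 0# ≤ fromℕ n
  0≤fromℕ zero = ≤-refl
  0≤fromℕ (suc n) = <⇒≤ (0<fromℕ {suc n} (ℕ.s≤s ℕ.z≤n))

  n<1+n : ∀ n → fromℕ n < fromℕ (suc n)
  n<1+n n = <-respˡ-≈ (+-identityʳ _) (<-respʳ-≈ (+-comm (fromℕ n) 1#) (+-monoʳ-< (fromℕ n) 0<1))

  fromℕ-mono-≤ : ∀ {m n} → m ℕ.≤ n → fromℕ m ≤ fromℕ n
  fromℕ-mono-≤ {n = n} ℕ.z≤n = 0≤fromℕ n
  fromℕ-mono-≤ (ℕ.s≤s m≤n) = +-monoʳ-≤ 1# (fromℕ-mono-≤ m≤n)

  fromℕ-cancel-≤ : ∀ {m n} → fromℕ m ≤ fromℕ n → m ℕ.≤ n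
  fromℕ-cancel-≤ {m} {n} le = ℕₚ.≮⇒≥ λ n<m → le (<-≤-trans (n<1+n n) (fromℕ-mono-≤ n<m))

  -- Exponential and logarithm from the axioms

  exp-0 : exp 0# ≈ 1#
  -- exp 0 is idempotent and at least 1, and an idempotent above 1 would be smaller than its own
  -- square.
  exp-0 = ≤-antisym (λ 1<e → <-irrefl (trans (*-identityʳ e) idem) (*-monoʳ-< 0<e 1<e)) 1≤e
    where
    e = exp 0#
    1≤e : 1# ≤ e
    1≤e = ≤-trans (≤-reflexive (sym (+-identityʳ 1#))) (1+x≤exp 0#)
    0<e = 1≤x⇒0<x 1≤e
    idem : e ≈ e * e
    idem = trans (exp-cong (sym (+-identityʳ 0#))) (exp-+ 0# 0#)

  exp-inverseˡ : ∀ x → exp (- x) * exp x ≈ 1#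
  exp-inverseˡ x = trans (sym (exp-+ (- x) x)) (trans (exp-cong (-‿inverseˡ x)) exp-0)

  0<1+x : ∀ {x} → 0# ≤ x → 0# < 1# + x
  0<1+x {x} 0≤x = <-≤-trans 0<1 (≤-trans (≤-reflexive (sym (+-identityʳ 1#))) (+-monoʳ-≤ 1# 0≤x))

  -- For negative x, positivity follows from exp (-x) exp x = 1 and exp (-x) > 0. The double
  -- negation suffices because it only serves to prove `≤`, which is itself a negation.
  exp-pos : ∀ x → ¬ ¬ (0# < exp x)
  exp-pos x k = <-tri x 0# λ
    { (inj₁ x<0) → let 0<f = <-≤-trans (0<1+x (<⇒≤ (<-respʳ-≈ (+-identityʳ (- x)) (x<y⇒0<-x+y x<0)))) (1+x≤exp (- x)) in
        <-tri 0# (exp x) λ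
        { (inj₁ 0<e) → k 0<e
        ; (inj₂ (inj₁ 0≈e)) → <-irrefl (trans (sym (zeroʳ (exp (- x)))) (trans (*-congˡ 0≈e) (exp-inverseˡ x))) 0<1
        ; (inj₂ (inj₂ e<0)) → <-asym 0<1 (<-respˡ-≈ (exp-inverseˡ x) (<-respʳ-≈ (zeroʳ _) (*-monoʳ-< 0<f e<0))) }
    ; (inj₂ (inj₁ x≈0)) → k (<-respʳ-≈ (sym (trans (exp-cong x≈0) exp-0)) 0<1)
    ; (inj₂ (inj₂ 0<x)) → k (<-≤-trans (0<1+x (<⇒≤ 0<x)) (1+x≤exp x)) }

  0≤exp : ∀ x → 0# ≤ exp x
  0≤exp x e<0 = exp-pos x λ 0<e → <-asym 0<e e<0

  exp-split : ∀ x y → exp y ≈ exp x * exp (- x + y)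
  exp-split x y = trans (exp-cong (sym (\\-leftDividesˡ x y))) (exp-+ x (- x + y))

  -- exp y is exp x times exp (y - x), and the latter is at least 1 + (y - x) ≥ 1.
  exp-mono-≤ : ∀ {x y} → x ≤ y → exp x ≤ exp y
  exp-mono-≤ {x} {y} x≤y = begin
    exp x                   ≈⟨ *-identityʳ (exp x) ⟨
    exp x * 1#              ≈⟨ *-congˡ (+-identityʳ 1#) ⟨
    exp x * (1# + 0#)       ≤⟨ *-monoʳ-≤ (0≤exp x) (≤-trans (+-monoʳ-≤ 1# 0≤y-x) (1+x≤exp (- x + y))) ⟩
    exp x * exp (- x + y)   ≈⟨ exp-split x y ⟨
    exp y                   ∎
    where
    0≤y-x : 0# ≤ - x + y
    0≤y-x = ≤-trans (≤-reflexive (sym (-‿inverseˡ x))) (+-monoʳ-≤ (- x) x≤y)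

  exp-cancel-≤ : ∀ {x y} → exp x ≤ exp y → x ≤ y
  exp-cancel-≤ {x} {y} le y<x = exp-pos y λ 0<e →
    le (<-respˡ-≈ (*-identityʳ (exp y)) (<-respʳ-≈ (sym (exp-split y x)) (*-monoʳ-< 0<e 1<exp)))
    where
    1<exp : 1# < exp (- y + x)
    1<exp = <-≤-trans (<-respˡ-≈ (+-identityʳ 1#) (+-monoʳ-< 1# (x<y⇒0<-x+y y<x))) (1+x≤exp (- y + x))

  exp≤⇒≤ln : ∀ {y} x → exp y ≤ proj₁ x → y ≤ ln x
  exp≤⇒≤ln x le = exp-cancel-≤ (≤-trans le (≤-reflexive (sym (exp-ln x))))

  ≤exp⇒ln≤ : ∀ {y} x → proj₁ x ≤ exp y → ln x ≤ y
  ≤exp⇒ln≤ x le = exp-cancel-≤ (≤-trans (≤-reflexive (exp-ln x)) le)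

  2≤exp-1 : fromℕ 2 ≤ exp 1#
  2≤exp-1 = ≤-trans (≤-reflexive (+-congˡ (+-identityʳ 1#))) (1+x≤exp 1#)

  -- 1/2 ≤ exp (- 1/2) gives exp (1/2) ≤ 2.
  exp-1≤4 : exp 1# ≤ fromℕ 4
  exp-1≤4 = begin
    exp 1#              ≈⟨ exp-cong h+h≈1 ⟨
    exp (h + h)         ≈⟨ exp-+ h h ⟩
    exp h * exp h       ≤⟨ *-mono-≤ (0≤exp h) (0≤fromℕ 2) exp-h≤2 exp-h≤2 ⟩
    fromℕ 2 * fromℕ 2   ≈⟨ fromℕ-* 2 2 ⟨
    fromℕ 4             ∎
    where
    2⁺ = fromℕ⁺ 2 (ℕ.s≤s ℕ.z≤n)
    h = recip 2⁺
    2*x≈x+x : ∀ x → fromℕ 2 * x ≈ x + x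
    2*x≈x+x x = trans (distribʳ x 1# (fromℕ 1)) (+-cong (*-identityˡ x) (trans (*-congʳ fromℕ-1) (*-identityˡ x)))
    h+h≈1 : h + h ≈ 1#
    h+h≈1 = trans (sym (2*x≈x+x h)) (*-inverseʳ 2⁺)
    h≈1-h : h ≈ 1# + - h
    h≈1-h = begin-equality
      h             ≈⟨ \\-leftDividesʳ h h ⟨
      - h + (h + h) ≈⟨ +-congˡ h+h≈1 ⟩
      - h + 1#      ≈⟨ +-comm (- h) 1# ⟩
      1# + - h      ∎
    exp-h≤2 : exp h ≤ fromℕ 2
    exp-h≤2 = begin
      exp h                        ≈⟨ *-recip 2⁺ (exp h) ⟨
      fromℕ 2 * (exp h * h)        ≤⟨ *-monoʳ-≤ (0≤fromℕ 2) (*-monoʳ-≤ (0≤exp h) (≤-trans (≤-reflexive h≈1-h) (1+x≤exp (- h)))) ⟩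
      fromℕ 2 * (exp h * exp (- h)) ≈⟨ *-congˡ (trans (*-comm (exp h) (exp (- h))) (exp-inverseˡ h)) ⟩
      fromℕ 2 * 1#                 ≈⟨ *-identityʳ (fromℕ 2) ⟩
      fromℕ 2                      ∎

  -- With `exp-n≤4^n` this rests on 2 ≤ e ≤ 4: upper bounds for logarithms come from powers of 2,
  -- lower bounds from powers of 4, and the gap goes into the constants.
  2^n≤exp-n : ∀ n → fromℕ (2 ℕ.^ n) ≤ exp (fromℕ n)
  2^n≤exp-n zero = ≤-reflexive (trans fromℕ-1 (sym exp-0))
  2^n≤exp-n (suc n) = begin
    fromℕ (2 ℕ.* 2 ℕ.^ n)       ≈⟨ fromℕ-* 2 (2 ℕ.^ n) ⟩
    fromℕ 2 * fromℕ (2 ℕ.^ n)   ≤⟨ *-mono-≤ (0≤fromℕ 2) (0≤exp _) 2≤exp-1 (2^n≤exp-n n) ⟩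
    exp 1# * exp (fromℕ n)      ≈⟨ exp-+ 1# (fromℕ n) ⟨
    exp (fromℕ (suc n))         ∎

  exp-n≤4^n : ∀ n → exp (fromℕ n) ≤ fromℕ (4 ℕ.^ n)
  exp-n≤4^n zero = ≤-reflexive (trans exp-0 (sym fromℕ-1))
  exp-n≤4^n (suc n) = begin
    exp (fromℕ (suc n))         ≈⟨ exp-+ 1# (fromℕ n) ⟩
    exp 1# * exp (fromℕ n)      ≤⟨ *-mono-≤ (0≤exp 1#) (0≤fromℕ (4 ℕ.^ n)) exp-1≤4 (exp-n≤4^n n) ⟩
    fromℕ 4 * fromℕ (4 ℕ.^ n)   ≈⟨ fromℕ-* 4 (4 ℕ.^ n) ⟨
    fromℕ (4 ℕ.* 4 ℕ.^ n)       ∎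

  -- Truncated logarithms and transfer between ℝ and ℕ

  ln≤log : ∀ x → ln x ≤ proj₁ (log x)
  ln≤log x = proj₁ (∨-supremum (ln x) 1#)

  1≤log : ∀ x → 1# ≤ proj₁ (log x)
  1≤log x = proj₁ (proj₂ (∨-supremum (ln x) 1#))

  log-lub : ∀ {y} x → ln x ≤ y → 1# ≤ y → proj₁ (log x) ≤ y
  log-lub {y} x = proj₂ (proj₂ (∨-supremum (ln x) 1#)) y

  4^n≤x⇒n≤log : ∀ n x → fromℕ (4 ℕ.^ n) ≤ proj₁ x → fromℕ n ≤ proj₁ (log x)
  4^n≤x⇒n≤log n x le = ≤-trans (exp≤⇒≤ln x (≤-trans (exp-n≤4^n n) le)) (ln≤log x)

  x≤2^n⇒log≤n : ∀ n x → 1 ℕ.≤ n → proj₁ x ≤ fromℕ (2 ℕ.^ n) → proj₁ (log x) ≤ fromℕ n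
  x≤2^n⇒log≤n n x 1≤n le = log-lub x (≤exp⇒ln≤ x (≤-trans le (2^n≤exp-n n)))
    (≤-trans (≤-reflexive (sym fromℕ-1)) (fromℕ-mono-≤ 1≤n))

  -- The order is not assumed decidable, so no exact rounding up is attempted. Cotransitivity over
  -- the gap from k to k + 1 still places r between k and k + 2, and R = k + 2 ≤ 2 r + r since r ≥
  -- 1.
  approximate : ∀ r → 1# ≤ r → ∃[ R ] r ≤ fromℕ R × fromℕ R ≤ fromℕ 4 * r
  approximate r 1≤r with archimedean r
  ... | N , r<N = search N (<-≤-trans r<N (<⇒≤ (n<1+n N)))
    where
    0≤r = <⇒≤ (1≤x⇒0<x 1≤r)
    1≤⇒n≤n*r : ∀ n → fromℕ n ≤ fromℕ n * r
    1≤⇒n≤n*r n = ≤-trans (≤-reflexive (sym (*-identityʳ (fromℕ n)))) (*-monoʳ-≤ (0≤fromℕ n) 1≤r)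
    weaken : ∀ n → n ℕ.≤ 4 → fromℕ n * r ≤ fromℕ 4 * r
    weaken n n≤4 = *-monoˡ-≤ 0≤r (fromℕ-mono-≤ n≤4)
    search : ∀ k → r < fromℕ (suc k) → ∃[ R ] r ≤ fromℕ R × fromℕ R ≤ fromℕ 4 * r
    search zero r<1 = 1 , <⇒≤ r<1 , ≤-trans (1≤⇒n≤n*r 1) (weaken 1 (ℕ.s≤s ℕ.z≤n))
    search (suc k) r<2+k with <-cotrans (n<1+n k) r
    ... | inj₂ r<1+k = search k r<1+k
    ... | inj₁ k<r = 2 ℕ.+ k , <⇒≤ r<2+k , (begin
      fromℕ (2 ℕ.+ k)   ≈⟨ fromℕ-+ 2 k ⟩
      fromℕ 2 + fromℕ k ≤⟨ +-mono-≤ (1≤⇒n≤n*r 2) (<⇒≤ k<r) ⟩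
      fromℕ 2 * r + r   ≈⟨ +-comm _ r ⟩
      r + fromℕ 2 * r   ≈⟨ +-congʳ (*-identityˡ r) ⟨
      1# * r + fromℕ 2 * r ≈⟨ distribʳ r 1# (fromℕ 2) ⟨
      fromℕ 3 * r       ≤⟨ weaken 3 (ℕ.s≤s (ℕ.s≤s (ℕ.s≤s ℕ.z≤n))) ⟩
      fromℕ 4 * r       ∎)

  -- R ≤ 4 r ≤ exp (2 + (C/L) ln n). Taking k-th powers multiplies the exponent by k, and k C/L ≤ 1
  -- leaves at most 2 k + ln n; exp (2 k) is then bounded by 4^(2 k).
  ≤^⇒^≤ : ∀ R c k {n r C} (1≤n : 1 ℕ.≤ n) (L : ℝ⁺) → C ≤ fromℕ c → fromℕ (k ℕ.* c) ≤ proj₁ L →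
    fromℕ R ≤ fromℕ 4 * r → r ≤ fromℕ⁺ n 1≤n ^ (C / L) → R ℕ.^ k ℕ.≤ 4 ℕ.^ (k ℕ.* 2) ℕ.* n
  ≤^⇒^≤ R c k {n} {r} {C} 1≤n L C≤c kc≤L R≤4r r≤ = fromℕ-cancel-≤ (begin
    fromℕ (R ℕ.^ k)                      ≤⟨ powers k ⟩
    exp (fromℕ k * (fromℕ 2 + a))        ≤⟨ exp-mono-≤ exponent≤ ⟩
    exp (fromℕ (k ℕ.* 2) + ln n⁺)        ≈⟨ exp-+ (fromℕ (k ℕ.* 2)) (ln n⁺) ⟩
    exp (fromℕ (k ℕ.* 2)) * exp (ln n⁺)  ≤⟨ *-mono-≤ (0≤exp _) (0≤fromℕ n) (exp-n≤4^n (k ℕ.* 2))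
                                              (≤-reflexive (exp-ln n⁺)) ⟩
    fromℕ (4 ℕ.^ (k ℕ.* 2)) * fromℕ n    ≈⟨ fromℕ-* (4 ℕ.^ (k ℕ.* 2)) n ⟨
    fromℕ (4 ℕ.^ (k ℕ.* 2) ℕ.* n)        ∎)
    where
    n⁺ = fromℕ⁺ n 1≤n
    a = C / L * ln n⁺
    R≤exp : fromℕ R ≤ exp (fromℕ 2 + a)
    R≤exp = begin
      fromℕ R                   ≤⟨ R≤4r ⟩
      fromℕ 4 * r               ≤⟨ *-monoʳ-≤ (0≤fromℕ 4) r≤ ⟩
      fromℕ 4 * exp a           ≤⟨ *-monoˡ-≤ (0≤exp a) (2^n≤exp-n 2) ⟩
      exp (fromℕ 2) * exp a     ≈⟨ exp-+ (fromℕ 2) a ⟨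
      exp (fromℕ 2 + a)         ∎
    powers : ∀ j → fromℕ (R ℕ.^ j) ≤ exp (fromℕ j * (fromℕ 2 + a))
    powers zero = ≤-reflexive (trans fromℕ-1 (sym (trans (exp-cong (zeroˡ _)) exp-0)))
    powers (suc j) = begin
      fromℕ (R ℕ.* R ℕ.^ j)                                   ≈⟨ fromℕ-* R (R ℕ.^ j) ⟩
      fromℕ R * fromℕ (R ℕ.^ j)                               ≤⟨ *-mono-≤ (0≤fromℕ R) (0≤exp _) R≤exp (powers j) ⟩
      exp (fromℕ 2 + a) * exp (fromℕ j * (fromℕ 2 + a))       ≈⟨ exp-+ _ _ ⟨
      exp ((fromℕ 2 + a) + fromℕ j * (fromℕ 2 + a))           ≈⟨ exp-cong (+-congʳ (*-identityˡ _)) ⟨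
      exp (1# * (fromℕ 2 + a) + fromℕ j * (fromℕ 2 + a))      ≈⟨ exp-cong (distribʳ _ 1# (fromℕ j)) ⟨
      exp (fromℕ (suc j) * (fromℕ 2 + a))                     ∎
    0≤ln : 0# ≤ ln n⁺
    0≤ln = exp≤⇒≤ln n⁺ (begin
      exp 0#   ≈⟨ trans exp-0 (sym fromℕ-1) ⟩
      fromℕ 1  ≤⟨ fromℕ-mono-≤ 1≤n ⟩
      fromℕ n  ∎)
    kC/L≤1 : fromℕ k * (C / L) ≤ 1#
    kC/L≤1 = *-cancelˡ-≤ (proj₂ L) (begin
      proj₁ L * (fromℕ k * (C / L)) ≈⟨ *-congˡ (*-assoc (fromℕ k) C (recip L)) ⟨
      proj₁ L * ((fromℕ k * C) / L) ≈⟨ *-recip L (fromℕ k * C) ⟩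
      fromℕ k * C                   ≤⟨ *-monoʳ-≤ (0≤fromℕ k) C≤c ⟩
      fromℕ k * fromℕ c             ≈⟨ fromℕ-* k c ⟨
      fromℕ (k ℕ.* c)               ≤⟨ kc≤L ⟩
      proj₁ L                       ≈⟨ *-identityʳ (proj₁ L) ⟨
      proj₁ L * 1#                  ∎)
    exponent≤ : fromℕ k * (fromℕ 2 + a) ≤ fromℕ (k ℕ.* 2) + ln n⁺
    exponent≤ = begin
      fromℕ k * (fromℕ 2 + a)           ≈⟨ distribˡ (fromℕ k) (fromℕ 2) a ⟩
      fromℕ k * fromℕ 2 + fromℕ k * a   ≤⟨ +-mono-≤ (≤-reflexive (sym (fromℕ-* k 2))) (begin
        fromℕ k * (C / L * ln n⁺)         ≈⟨ *-assoc (fromℕ k) (C / L) (ln n⁺) ⟨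
        fromℕ k * (C / L) * ln n⁺         ≤⟨ *-monoˡ-≤ 0≤ln kC/L≤1 ⟩
        1# * ln n⁺                        ≈⟨ *-identityˡ (ln n⁺) ⟩
        ln n⁺                             ∎) ⟩
      fromℕ (k ℕ.* 2) + ln n⁺           ∎

  -- Taking logarithms gives h ≤ 2 + ln r. The resulting constant 3 is absorbed by 3 log r, because
  -- log is at least 1 by convention.
  4^h≤4r⇒1+h≤4*log : ∀ h r⁺ → fromℕ (4 ℕ.^ h) ≤ fromℕ 4 * proj₁ r⁺ →
    fromℕ (suc h) ≤ fromℕ 4 * proj₁ (log r⁺)
  4^h≤4r⇒1+h≤4*log h r⁺ 4^h≤4r = begin
    1# + fromℕ h               ≤⟨ +-monoʳ-≤ 1# (exp-cancel-≤ exp-h≤) ⟩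
    1# + (fromℕ 2 + ln r⁺)     ≈⟨ +-assoc 1# (fromℕ 2) (ln r⁺) ⟨
    fromℕ 3 + ln r⁺            ≤⟨ +-mono-≤ (≤-trans (≤-reflexive (sym (*-identityʳ (fromℕ 3)))) (*-monoʳ-≤ (0≤fromℕ 3) (1≤log r⁺))) (ln≤log r⁺) ⟩
    fromℕ 3 * ℓ + ℓ            ≈⟨ +-comm _ ℓ ⟩
    ℓ + fromℕ 3 * ℓ            ≈⟨ +-congʳ (*-identityˡ ℓ) ⟨
    1# * ℓ + fromℕ 3 * ℓ       ≈⟨ distribʳ ℓ 1# (fromℕ 3) ⟨
    fromℕ 4 * ℓ                ∎
    where
    ℓ = proj₁ (log r⁺)
    exp-h≤ : exp (fromℕ h) ≤ exp (fromℕ 2 + ln r⁺)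
    exp-h≤ = begin
      exp (fromℕ h)              ≤⟨ exp-n≤4^n h ⟩
      fromℕ (4 ℕ.^ h)            ≤⟨ 4^h≤4r ⟩
      fromℕ 4 * proj₁ r⁺         ≤⟨ *-mono-≤ (0≤fromℕ 4) (0≤exp (ln r⁺)) (2^n≤exp-n 2) (≤-reflexive (sym (exp-ln r⁺))) ⟩
      exp (fromℕ 2) * exp (ln r⁺) ≈⟨ exp-+ (fromℕ 2) (ln r⁺) ⟨
      exp (fromℕ 2 + ln r⁺)      ∎

  -- 320 = 4 · 5 · 4 · 4: log log r ≤ 4 s, s E ≤ 5 (4 (h + 1)) and h + 1 ≤ 4 log r.
  2^E≤^ᴸ : ∀ E h s {K} r⁺ → 1 ℕ.≤ s → proj₁ r⁺ ≤ fromℕ (4 ℕ.^ suc h) →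
    fromℕ (suc h) ≤ fromℕ 4 * proj₁ (log r⁺) →
    4 ℕ.* suc h ℕ.< 4 ℕ.^ suc s → s ℕ.* E ℕ.≤ 5 ℕ.* (4 ℕ.* suc h) → fromℕ 320 ≤ K →
    fromℕ (2 ℕ.^ E) ≤ r⁺ ^ᴸ (K / log (log r⁺))
  2^E≤^ᴸ E h s {K} r⁺ 1≤s r≤ h≤ L< sE≤ 320≤K = ≤-trans (2^n≤exp-n E) (exp-mono-≤ (*-cancelˡ-≤ (proj₂ (log (log r⁺))) (begin
    ll * fromℕ E                    ≤⟨ *-monoˡ-≤ (0≤fromℕ E) ll≤4s ⟩
    fromℕ (4 ℕ.* s) * fromℕ E       ≈⟨ fromℕ-* (4 ℕ.* s) E ⟨
    fromℕ (4 ℕ.* s ℕ.* E)           ≤⟨ fromℕ-mono-≤ nat ⟩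
    fromℕ (80 ℕ.* suc h)            ≈⟨ fromℕ-* 80 (suc h) ⟩
    fromℕ 80 * fromℕ (suc h)        ≤⟨ *-monoʳ-≤ (0≤fromℕ 80) h≤ ⟩
    fromℕ 80 * (fromℕ 4 * ℓ)        ≈⟨ *-assoc (fromℕ 80) (fromℕ 4) ℓ ⟨
    fromℕ 80 * fromℕ 4 * ℓ          ≈⟨ *-congʳ (fromℕ-* 80 4) ⟨
    fromℕ 320 * ℓ                   ≤⟨ *-monoˡ-≤ (<⇒≤ (proj₂ (log r⁺))) 320≤K ⟩
    K * ℓ                           ≈⟨ *-congʳ (*-recip (log (log r⁺)) K) ⟨
    ll * (K / log (log r⁺)) * ℓ     ≈⟨ *-assoc ll (K / log (log r⁺)) ℓ ⟩
    ll * (K / log (log r⁺) * ℓ)     ∎)))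
    where
    ℓ = proj₁ (log r⁺)
    ll = proj₁ (log (log r⁺))
    4^≡ : ∀ k → fromℕ (4 ℕ.^ k) ≤ fromℕ (2 ℕ.^ (2 ℕ.* k))
    4^≡ k = fromℕ-mono-≤ (ℕₚ.≤-reflexive (ℕₚ.^-*-assoc 2 2 k))
    ℓ≤L : ℓ ≤ fromℕ (4 ℕ.* suc h)
    ℓ≤L = ≤-trans (x≤2^n⇒log≤n (2 ℕ.* suc h) r⁺ (ℕ.s≤s ℕ.z≤n) (≤-trans r≤ (4^≡ (suc h))))
      (fromℕ-mono-≤ (ℕₚ.*-monoˡ-≤ (suc h) {2} {4} (ℕ.s≤s (ℕ.s≤s ℕ.z≤n))))
    ll≤ : ll ≤ fromℕ (2 ℕ.* suc s)
    ll≤ = x≤2^n⇒log≤n (2 ℕ.* suc s) (log r⁺) (ℕ.s≤s ℕ.z≤n)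
      (≤-trans ℓ≤L (≤-trans (fromℕ-mono-≤ (ℕₚ.<⇒≤ L<)) (4^≡ (suc s))))
    ll≤4s : ll ≤ fromℕ (4 ℕ.* s)
    ll≤4s = ≤-trans ll≤ (fromℕ-mono-≤ (ℕₚ.≤-trans (ℕₚ.*-monoʳ-≤ 2 (ℕₚ.+-monoˡ-≤ s 1≤s)) (ℕₚ.≤-reflexive
      (≡.trans (≡.cong (λ x → 2 ℕ.* (s ℕ.+ x)) (≡.sym (ℕₚ.+-identityʳ s))) (≡.sym (ℕₚ.*-assoc 2 2 s))))))
    nat : 4 ℕ.* s ℕ.* E ℕ.≤ 80 ℕ.* suc h
    nat = ℕₚ.≤-trans (ℕₚ.≤-reflexive (ℕₚ.*-assoc 4 s E)) (ℕₚ.≤-trans (ℕₚ.*-monoʳ-≤ 4 sE≤)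
      (ℕₚ.≤-reflexive (≡.trans (≡.cong (4 ℕ.*_) (≡.sym (ℕₚ.*-assoc 5 4 (suc h)))) (≡.sym (ℕₚ.*-assoc 4 20 (suc h))))))

-- Assembling the divisor

open Arithmetic
open ℕₚ using (<⇒≤)

-- The constant of `σ-class` for β + 1 = 4^(4 (c + 1)). Using c + 1 instead of c keeps the exponent
-- visibly nonzero.
σ-constant : ℕ → ℕ
σ-constant c = 6 ℕ.* (suc β ℕ.* suc β)
  where open Thresholds (4 ℕ.* suc c) using (β)

module Construction {a ℓ₁ ℓ₂ : Level} (ℛ : Reals a ℓ₁ ℓ₂) where
  open Reals ℛ hiding (refl; sym; trans)

  module _ {C : ℝ} (c : ℕ) (C<c : C < fromℕ c) (n : ℕ) (2≤n : 2 ℕ.≤ n) (r : ℝ) (1≤r : 1# ≤ r)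
    (r≤n : r ≤ fromℕ n)
    (r≤n^ : r ≤ fromℕ⁺ n (<⇒≤ 2≤n) ^ (C / log (log (log (fromℕ⁺ n (<⇒≤ 2≤n))))))
    where

    open RealAnalysis ℛ hiding (<⇒≤)
    open Thresholds (4 ℕ.* suc c)
    open ≡ using (_≡_; refl; sym; subst)

    n⁺ r⁺ : ℝ⁺
    n⁺ = fromℕ⁺ n (<⇒≤ 2≤n)
    r⁺ = r , 1≤x⇒0<x 1≤r

    instance
      n≢0 : ℕ.NonZero n
      n≢0 = ℕ.>-nonZero (<⇒≤ 2≤n)

    -- Capping at n keeps r ≤ R because r ≤ n, and supplies R ≤ n, which is what a single class
    -- requires.
    R₀ R : ℕ
    R₀ = proj₁ (approximate r 1≤r)
    R = R₀ ℕ.⊓ n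

    r≤R : r ≤ fromℕ R
    r≤R with ℕₚ.⊓-sel R₀ n
    ... | inj₁ R≡R₀ = subst (λ x → r ≤ fromℕ x) (sym R≡R₀) (proj₁ (proj₂ (approximate r 1≤r)))
    ... | inj₂ R≡n = subst (λ x → r ≤ fromℕ x) (sym R≡n) r≤n

    R≤4r : fromℕ R ≤ fromℕ 4 * r
    R≤4r = ≤-trans (fromℕ-mono-≤ (ℕₚ.m⊓n≤m R₀ n)) (proj₂ (proj₂ (approximate r 1≤r)))

    1≤R : 1 ℕ.≤ R
    1≤R = fromℕ-cancel-≤ (≤-trans (≤-reflexive fromℕ-1) (≤-trans 1≤r r≤R))

    -- For G ≥ 1 the lower threshold yields 4 (c + 1) G ≤ log log log n, so the exponent C / log log
    -- log n allows the power 2 (G + 1). For G = 0 there may be no such lower bound on n, and the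
    -- cap in `R` is used.
    R^[1+G]≤n : ∀ G → G ≡ 0 ⊎ threshold G ℕ.≤ n → R ℕ.^ suc G ℕ.≤ n
    R^[1+G]≤n zero _ = subst (ℕ._≤ n) (sym (ℕₚ.*-identityʳ R)) (ℕₚ.m⊓n≤n R₀ n)
    R^[1+G]≤n G@(suc _) (inj₂ θ≤n) = halve-exponent {R} {n} G θ≤n
      (≤^⇒^≤ R (suc c) (2 ℕ.* suc G) (<⇒≤ 2≤n) (log (log (log n⁺)))
        (RealAnalysis.<⇒≤ ℛ (<-trans C<c (n<1+n c)))
        (≤-trans (fromℕ-mono-≤ (2*[1+g]*c≤4*c*g (suc c) G)) j≤logloglog) R≤4r r≤n^)
      where
      j = 4 ℕ.* suc c ℕ.* G
      j≤logloglog : fromℕ j ≤ proj₁ (log (log (log n⁺)))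
      j≤logloglog =
        4^n≤x⇒n≤log j (log (log n⁺))
          (4^n≤x⇒n≤log (4 ℕ.^ j) (log n⁺)
            (4^n≤x⇒n≤log (4 ℕ.^ 4 ℕ.^ j) n⁺
              (fromℕ-mono-≤ (subst (ℕ._≤ n) (threshold≡ G) θ≤n))))

    module _ {K : ℝ} (320≤K : fromℕ 320 ≤ K) {T : List ℕ} (T-prime : All Prime T)
      (small : Singleton T ⊎ product T ℕ.≤ R ℕ.* R) where

      d-bound : ∀ h s → R ℕ.< 4 ℕ.^ suc h → h ≡ 0 ⊎ 4 ℕ.^ h ℕ.≤ R →
        4 ℕ.* suc h ℕ.< 4 ℕ.^ suc s → s ≡ 0 ⊎ 4 ℕ.^ s ℕ.≤ 4 ℕ.* suc h →
        fromℕ (d (product T)) ≤ r⁺ ^ᴸ (K / log (log r⁺))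
      -- The lower inequality left open by `bracket` at s = 0 does not matter: 4 (h + 1) is at least
      -- 4, so s = 0 cannot occur.
      d-bound h zero _ _ L<4 _ = contradiction (ℕₚ.m≤m*n 4 (suc h)) (ℕₚ.<⇒≱ L<4)
      d-bound h s@(suc _) R<4^ 4^≤R L< (inj₂ s≤) with d-small h s T-prime small R<4^ s≤ L<
      ... | E , d≤2^E , sE≤ = ≤-trans (fromℕ-mono-≤ d≤2^E)
        (2^E≤^ᴸ E h s r⁺ (ℕ.s≤s ℕ.z≤n)
          (≤-trans r≤R (fromℕ-mono-≤ (<⇒≤ R<4^)))
          (4^h≤4r⇒1+h≤4*log h r⁺ (≤-trans (fromℕ-mono-≤ (4^h≤R 4^≤R)) R≤4r))
          L< sE≤ 320≤K)
        where
        4^h≤R : h ≡ 0 ⊎ 4 ℕ.^ h ℕ.≤ R → 4 ℕ.^ h ℕ.≤ R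
        4^h≤R (inj₁ refl) = 1≤R
        4^h≤R (inj₂ le) = le

    divisor : let K = fromℕ (320 ℕ.+ σ-constant c) in
      ∃[ m ] (m ∣ n) × (r ≤ fromℕ m)
        × (fromℕ (d m) ≤ r⁺ ^ᴸ (K / log (log r⁺)))
        × (fromℕ (σ m) ≤ K * fromℕ m)
    -- `G` is the index of the last class for n, `h` is about the base-4 logarithm of `R`, and `s`
    -- below is that of 4 (h + 1), hence about log log r.
    divisor with bracket threshold n<threshold n | bracket (4 ℕ.^_) n<4^n R
    ... | G , n<θ , θ≤n | h , R<4^ , 4^≤R
      with divisor-σ β G 1≤R n<θ (R^[1+G]≤n G θ≤n) | bracket (4 ℕ.^_) n<4^n (4 ℕ.* suc h)
    ... | T , T-prime , T∣n , R≤T , small , σ≤KT | s , L< , s≤ =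
      product T , T∣n , ≤-trans r≤R (fromℕ-mono-≤ R≤T) ,
      d-bound (fromℕ-mono-≤ (ℕₚ.m≤m+n 320 (σ-constant c))) T-prime small h s R<4^ 4^≤R L< s≤ ,
      ≤-trans (fromℕ-mono-≤ (ℕₚ.≤-trans σ≤KT (ℕₚ.*-monoˡ-≤ (product T) (ℕₚ.m≤n+m (σ-constant c) 320))))
        (≤-reflexive (fromℕ-* (320 ℕ.+ σ-constant c) (product T)))

mainTheorem6 : ∀ {c ℓ₁ ℓ₂} (R : Reals c ℓ₁ ℓ₂) → let open Reals R in
    ∀ (C : ℝ) → 0# < C →
    ∃[ K ] (0# < K) ×
      (∀ (n : ℕ) (2≤n : 2 ℕ.≤ n) (r : ℝ) (1≤r : 1# ≤ r) →
        let n⁺ = fromℕ⁺ n (<⇒≤ 2≤n)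
            r⁺ = (r , 1≤x⇒0<x 1≤r)
        in
        r ≤ fromℕ n →
        r ≤ n⁺ ^ (C / log (log (log n⁺))) →
        ∃[ m ] (m ∣ n) × (r ≤ fromℕ m)
          × (fromℕ (d m) ≤ r⁺ ^ᴸ (K / log (log r⁺)))
          × (fromℕ (σ m) ≤ K * fromℕ m))
mainTheorem6 R C _ with Reals.archimedean R C
-- The sum dominates both 320, needed for d(m), and the constant needed for σ(m).
... | c , C<c = fromℕ (320 ℕ.+ σ-constant c) , 0<fromℕ {320 ℕ.+ σ-constant c} (ℕ.s≤s ℕ.z≤n) ,
    λ n 2≤n r 1≤r → Construction.divisor R c C<c n 2≤n r 1≤r
  where open Reals R using (fromℕ; 0<fromℕ)
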